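{- For each nonnegative integer $k$, the map $\pi\mapsto\mathrm{DL}_k(\mathrm{swl}(\pi))$ restricted to $\mathcal U_{2k+1}(132,231)$ is a bijection from $\mathcal U_{2k+1}(132,231)$ to $\mathrm{Int}(\mathcal A_k)=\{(\Lambda,\Lambda):\Lambda\in\mathbf D_k\}$. Hence $|\mathcal U_{2k+1}(132,231)|=C_k=\frac{1}{k+1}\binom{2k}{k}$.
   Context: Permutations are finite words of distinct positive integers; $S_n$ is the set of permutations of $[n]$. The stack-sorting map $s$: $s(\text{empty})=\text{empty}$, and if $\pi=LnR$ with $n$ the largest entry, $s(\pi)=s(L)s(R)n$. $\pi$ is uniquely sorted if it has exactly one preimage under $s$. A permutation avoids $\tau$ if no subsequence has the same relative order as $\tau$; $\mathcal U_n(\tau^{(1)},\dots)$ is the set of uniquely sorted permutations in $S_n$ avoiding the listed patterns. A descent of $\pi$ is an index $i$ with $\pi_i>\pi_{i+1}$; $\mathrm{Des}(\pi)$ is the set of descents. $\mathrm{rot}(\pi)=\mathrm{rev}(\pi^{ -1})$, where $\mathrm{rev}$ reverses the word and $\pi^{ -1}$ is the group inverse; $\mathrm{rot}^{ -1}$ is its inverse. Sliding operators: for $\pi\in S_n$, $i\in[n]$, let $L_i$ (resp. $R_i$) be the set of elements of $[i-1]$ to the left (resp. right) of the entry $i$ in $\pi$. $\mathrm{swu}_i(\pi)$ has $j$-th entry $\pi_j$ if $\pi_j\ge i$, $m$ if $\pi_j$ is the $m$-th smallest element of $R_i$, and $i-m$ if $\pi_j$ is the $m$-th largest element of $L_i$.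 $\mathrm{swl}_i=\mathrm{rot}^{ -1}\circ\mathrm{swu}_i\circ\mathrm{rot}$ and $\mathrm{swl}=\mathrm{swl}_1\circ\cdots\circ\mathrm{swl}_n$ on $S_n$. $\mathbf D_k$ is the set of Dyck paths of semilength $k$ (words in $\{U,D\}$ with $k$ of each letter, every prefix having at least as many $U$'s as $D$'s); $\mathcal A_k$ is the antichain on $\mathbf D_k$; $\mathrm{Int}(P)$ is the set of pairs $(x,y)$ with $x\le y$ in $P$. For $\pi\in\mathcal U_{2k+1}(312)$, $n=2k+1$, let $\Lambda_i=D$ if $n-i\in\mathrm{Des}(\pi)$ and $U$ otherwise, $\Lambda'_i=U$ if $i\in\mathrm{Des}(\mathrm{rot}(\pi))$ and $D$ otherwise ($1\le i\le 2k$), and $\mathrm{DL}_k(\pi)=(\Lambda_1\cdots\Lambda_{2k},\Lambda'_1\cdots\Lambda'_{2k})$. -}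

module Defs where

open import Data.Bool using (Bool; true; false; if_then_else_; not; _∧_)
open import Data.Nat using (ℕ; zero; suc; _+_; _*_; _∸_; _≤_; _<_; _⊔_; _<ᵇ_; _≡ᵇ_; _/_)
open import Data.Nat.Combinatorics using (_C_)
open import Data.List using (List; []; _∷_; _++_; [_]; length; map; foldr; upTo; reverse; filterᵇ)
open import Data.List.Relation.Binary.Permutation.Propositional using (_↭_)
open import Data.List.Relation.Binary.Sublist.Propositional using (_⊆_)
open import Data.Product using (Σ; ∃; _×_; _,_)
open import Relation.Binary.PropositionalEquality using (_≡_)
open import Relation.Nullary using (¬_)

range1 : ℕ → List ℕ
range1 n = map suc (upTo n)

IsPerm : ℕ → List ℕ → Set
IsPerm n π = π ↭ range1 n

-- 1-based lookup π_i (junk value 0 out of range)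
_!_ : List ℕ → ℕ → ℕ
[] ! _ = 0
(x ∷ xs) ! zero = 0
(x ∷ xs) ! suc zero = x
(x ∷ xs) ! suc (suc i) = xs ! suc i

pos : ℕ → List ℕ → ℕ
pos v [] = 0
pos v (x ∷ xs) = if v ≡ᵇ x then 1 else suc (pos v xs)

maxL : List ℕ → ℕ
maxL = foldr _⊔_ 0

splitAtVal : ℕ → List ℕ → List ℕ × List ℕ
splitAtVal v [] = [] , []
splitAtVal v (x ∷ xs) with v ≡ᵇ x
... | true = [] , xs
... | false with splitAtVal v xs
...   | L , R = x ∷ L , R

-- Stack-sorting map: s(empty)=empty, s(L n R) = s(L) s(R) n.
-- Implemented with fuel (length π suffices since L, R are shorter).

sFuel : ℕ → List ℕ → List ℕ
sFuel _ [] = []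
sFuel zero (x ∷ xs) = []
sFuel (suc f) π@(x ∷ xs) with splitAtVal (maxL π) π
... | L , R = sFuel f L ++ sFuel f R ++ [ maxL π ]

s : List ℕ → List ℕ
s π = sFuel (length π) π

UniquelySorted : List ℕ → Set
UniquelySorted π =
  Σ (List ℕ) (λ σ → IsPerm (length π) σ × s σ ≡ π ×
    (∀ σ' → IsPerm (length π) σ' → s σ' ≡ π → σ' ≡ σ))

SameOrder : List ℕ → List ℕ → Set
SameOrder σ τ = length σ ≡ length τ ×
  (∀ i j → 1 ≤ i → i ≤ length σ → 1 ≤ j → j ≤ length σ →
     ((σ ! i) < (σ ! j) → (τ ! i) < (τ ! j)) ×
     ((τ ! i) < (τ ! j) → (σ ! i) < (σ ! j)))

Contains : List ℕ → List ℕ → Set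
Contains π τ = ∃ λ σ → σ ⊆ π × SameOrder σ τ

Avoids : List ℕ → List ℕ → Set
Avoids π τ = ¬ Contains π τ

InU132-231 : ℕ → List ℕ → Set
InU132-231 n π = IsPerm n π × UniquelySorted π ×
  Avoids π (1 ∷ 3 ∷ 2 ∷ []) × Avoids π (2 ∷ 3 ∷ 1 ∷ [])

isDes : List ℕ → ℕ → Bool
isDes π zero = false
isDes π (suc i) = (suc (suc i) <ᵇ suc (length π)) ∧ ((π ! suc (suc i)) <ᵇ (π ! suc i))

inv : List ℕ → List ℕ
inv π = map (λ j → pos j π) (range1 (length π))

rot : List ℕ → List ℕ
rot π = reverse (inv π)

rot⁻¹ : List ℕ → List ℕ
rot⁻¹ σ = inv (reverse σ)

countᵇ : (ℕ → Bool) → List ℕ → ℕ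
countᵇ p xs = length (filterᵇ p xs)

swu : ℕ → List ℕ → List ℕ
swu i π with splitAtVal i π
... | pre , post = map fL pre ++ i ∷ map fR post
  where
  -- entries < i left of i: m-th largest of L_i ↦ i - m
  fL : ℕ → ℕ
  fL x = if x <ᵇ i then i ∸ suc (countᵇ (λ y → (y <ᵇ i) ∧ (x <ᵇ y)) pre) else x
  -- entries < i right of i: m-th smallest of R_i ↦ m
  fR : ℕ → ℕ
  fR x = if x <ᵇ i then suc (countᵇ (λ y → y <ᵇ x) post) else x

swl-i : ℕ → List ℕ → List ℕ
swl-i i π = rot⁻¹ (swu i (rot π))

swl : List ℕ → List ℕ
swl π = foldr swl-i π (range1 (length π))

data Step : Set where
  U D : Step

isU isD : Step → Bool
isU U = true
isU D = false
isD s = not (isU s)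

#U #D : List Step → ℕ
#U w = length (filterᵇ isU w)
#D w = length (filterᵇ isD w)

IsDyck : ℕ → List Step → Set
IsDyck k w = #U w ≡ k × #D w ≡ k ×
  (∀ p q → p ++ q ≡ w → #D p ≤ #U p)

DL : ℕ → List ℕ → List Step × List Step
DL k π = map Λ (range1 (2 * k)) , map Λ′ (range1 (2 * k))
  where
  n = suc (2 * k)
  Λ : ℕ → Step
  Λ i = if isDes π (n ∸ i) then D else U
  Λ′ : ℕ → Step
  Λ′ i = if isDes (rot π) i then U else D

catalan : ℕ → ℕ
catalan k = ((2 * k) C k) / suc k

{-# OPTIONS --safe #-}
-- A permutation avoiding 132 and 231 has no peak, so it decreases to 1 and then increases; it is coded
-- by the word w over {U, D} telling, for the values from n down to 2, whether they lie right or left of 1.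
--
-- Stack-sorting: s is the post-order reading of the decreasing binary tree. A preimage of a peakless
-- permutation either can be modified to another preimage, or is tight, i.e. has the form
-- d_k a_k … d_1 a_1 c with c < d_1 < … < d_k, a_1 < … < a_k and d_i < a_i. Since 2 des(s σ) + 1 ≤ |σ|,
-- with equality for tight σ, a tight preimage is the only one. Hence uniquely sorted means
-- d_i < a_i for all i, which says that w is a Dyck word.
--
-- Sliding: rot carries swl to swu_n, …, swu_1 applied in turn. On the rotated permutation these operators
-- gather every block D^j U of w into an increasing run of consecutive values, the runs descending.
-- The reverse of the result is layered, hence an involution, so it equals swl π, and both descent
-- sets in DL spell w.
module Submission where

open import Defs
open import Data.Bool using (true; false; T; _∧_; if_then_else_)
open import Data.Bool.Properties using (T?)
open import Data.Empty using (⊥; ⊥-elim)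
open import Data.List hiding (_∷ʳ_)
open import Data.List.Membership.Propositional using (_∈_; _∉_)
open import Data.List.Membership.Propositional.Properties
  using (∈-++⁺ˡ; ∈-++⁺ʳ; ∈-++⁻; ∈-∃++; ∈-map⁺; ∈-map⁻)
open import Data.List.Properties
open import Data.List.Relation.Binary.Permutation.Propositional
  using (_↭_; prep; ↭-refl; ↭-sym; ↭-trans; ↭-reflexive; ↭⇒↭ₛ)
import Data.List.Relation.Binary.Permutation.Propositional.Properties as Perm
open import Data.List.Relation.Binary.Pointwise using (Pointwise; []; _∷_)
open import Data.List.Relation.Binary.Sublist.Propositional
  using (_⊆_; []; _∷_; _∷ʳ_; ⊆-refl; ⊆-trans; minimum)
open import Data.List.Relation.Binary.Sublist.Propositional.Properties
  using (All-resp-⊆; ++⁺; ++⁺ˡ; ++⁺ʳ)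
open import Data.List.Relation.Unary.All as All using (All; []; _∷_)
import Data.List.Relation.Unary.All.Properties as All
open import Data.List.Relation.Unary.AllPairs using (AllPairs; []; _∷_)
open import Data.List.Relation.Unary.Any using (here; there)
open import Data.List.Relation.Unary.Unique.Propositional using (Unique)
import Data.List.Relation.Unary.Unique.Propositional.Properties as Uniq
open import Data.Nat
open import Data.Nat.Combinatorics
  using (_C_; nCk≡nC[n∸k]; nCn≡1; nC1≡n; nCk+nC[k+1]≡[n+1]C[k+1]; k>n⇒nCk≡0)
open import Data.Nat.DivMod using (m*n/n≡m)
open import Data.Nat.Properties
open import Data.Nat.Tactic.RingSolver using (solve-∀)
open import Data.Product using (Σ; ∃; ∃₂; _×_; _,_; proj₁; proj₂)
open import Data.Sum using (_⊎_; inj₁; inj₂)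
open import Data.Unit using (tt)
open import Function using (_∘_; case_of_; id)
open import Function.Bundles using (_⇔_; mk⇔)
open import Relation.Binary.Definitions using (tri<; tri≈; tri>)
open import Relation.Binary.PropositionalEquality hiding ([_])
open import Relation.Nullary using (¬_; contradiction; yes; no)
import Data.List.Relation.Binary.Permutation.Setoid.Properties (setoid ℕ) as Permₛ

-- Stack-sorting as the post-order reading of decreasing trees

-- The two directions of the uniqueness criterion need different tools. Refuting uniqueness takes
-- just one other preimage, so moving one vertex or subtree of the tree is enough, and peaklessness
-- guarantees such a move wherever tightness fails. Proving uniqueness has to exclude every tree,
-- which a count does: delete the last entry from the image of a tight list with more than one
-- entry, and what remains has more descents than any stack-sorted list of its length. It can then
-- only be a junction of two nonempty images, and peaklessness leaves one place for the junction. On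
-- the sliding side the obstacle is conjugation: `rot` and `rot⁻¹` cancel only on permutations, so
-- the operators are followed entirely on rotated lists, together with a proof that each is a
-- permutation. A run, once gathered, is fixed by the operators of its own entries and transparent
-- to those of smaller entries; this is what permits induction over blocks.

splitAtVal-middle : ∀ {m} L R → All (_≢ m) L → splitAtVal m (L ++ m ∷ R) ≡ (L , R)
splitAtVal-middle {m} [] R [] with m ≡ᵇ m in eq
... | true  = refl
... | false = ⊥-elim (subst T eq (≡⇒≡ᵇ m m refl))
splitAtVal-middle {m} (x ∷ L) R (x≢m ∷ L≢m) with m ≡ᵇ x in eq
... | true  = contradiction (sym (≡ᵇ⇒≡ m x (subst T (sym eq) tt))) x≢m
... | false rewrite splitAtVal-middle L R L≢m = refl

maxL-bound : ∀ {m xs} → All (_< m) xs → maxL xs ≤ m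
maxL-bound []             = z≤n
maxL-bound (x<m ∷ xs<m) = ⊔-lub (<⇒≤ x<m) (maxL-bound xs<m)

maxL-middle : ∀ {m L R} → All (_< m) L → All (_< m) R → maxL (L ++ m ∷ R) ≡ m
maxL-middle []            R<m = m≥n⇒m⊔n≡m (maxL-bound R<m)
maxL-middle (x<m ∷ L<m) R<m rewrite maxL-middle L<m R<m = m≤n⇒m⊔n≡n (<⇒≤ x<m)

-- The decreasing binary tree whose in-order reading is the list; s is its post-order reading.
data DecTree : List ℕ → Set where
  leaf : DecTree []
  node : ∀ {L m R} → DecTree L → DecTree R → All (_< m) L → All (_< m) R → DecTree (L ++ m ∷ R)

split-max : ∀ x xs → Unique (x ∷ xs) →
  ∃ λ L → ∃₂ λ m R → x ∷ xs ≡ L ++ m ∷ R × All (_< m) L × All (_< m) R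
split-max x []       u = [] , x , [] , refl , [] , []
split-max x (y ∷ ys) ((x≢y ∷ x≢ys) ∷ u) with split-max y ys u
... | L , m , R , eq , L<m , R<m with <-cmp x m
... | tri< x<m _ _ = x ∷ L , m , R , cong (x ∷_) eq , x<m ∷ L<m , R<m
... | tri≈ _ refl _ = ⊥-elim (All.lookup (x≢y ∷ x≢ys) (subst (x ∈_) (sym eq) (∈-++⁺ʳ L (here refl))) refl)
... | tri> _ _ m<x = [] , x , y ∷ ys , refl , [] ,
  subst (All (_< x)) (sym eq) (All.++⁺ (All.map (λ p → <-trans p m<x) L<m)
      (m<x ∷ All.map (λ p → <-trans p m<x) R<m))

Unique-⊆ : ∀ {xs ys : List ℕ} → xs ⊆ ys → Unique ys → Unique xs
Unique-⊆ []          u         = []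
Unique-⊆ (y ∷ʳ p)    (_ ∷ u)  = Unique-⊆ p u
Unique-⊆ (refl ∷ p) (x≢ ∷ u) = All-resp-⊆ p x≢ ∷ Unique-⊆ p u

length-middle : ∀ (L : List ℕ) m R → length (L ++ m ∷ R) ≡ suc (length L + length R)
length-middle L m R = trans (length-++ L) (+-suc (length L) (length R))

Unique-left : ∀ (L : List ℕ) {R} → Unique (L ++ R) → Unique L
Unique-left L {R} = Unique-⊆ (++⁺ʳ R ⊆-refl)

Unique-right : ∀ (L : List ℕ) {m R} → Unique (L ++ m ∷ R) → Unique R
Unique-right L {m} = Unique-⊆ (++⁺ˡ L (m ∷ʳ ⊆-refl))

decTree : ∀ σ → Unique σ → DecTree σ
decTree σ u = go (length σ) σ ≤-refl u
  where
  go : ∀ n σ → length σ ≤ n → Unique σ → DecTree σ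
  go n       []      _  u = leaf
  go (suc n) (x ∷ xs) (s≤s le) u with split-max x xs u
  ... | L , m , R , eq , L<m , R<m =
    subst DecTree (sym eq) (node (go n L (≤-trans (m≤m+n _ _) le′) (Unique-left L u′))
                                 (go n R (≤-trans (m≤n+m _ _) le′) (Unique-right L u′)) L<m R<m)
    where
    u′ = subst Unique eq u
    le′ : length L + length R ≤ n
    le′ = ≤-trans (≤-reflexive (sym (suc-injective (trans (cong length eq) (length-middle L m R))))) le

sFuel-middle : ∀ f {m L R} → All (_< m) L → All (_< m) R →
  sFuel (suc f) (L ++ m ∷ R) ≡ sFuel f L ++ sFuel f R ++ [ m ]
sFuel-middle f {m} {L} {R} L<m R<m = go (L ++ m ∷ R) refl
  where
  body : ℕ → List ℕ × List ℕ → List ℕ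
  body v (l , r) = sFuel f l ++ sFuel f r ++ [ v ]
  -- `sFuel` reduces only on a cons cell, which `L ++ m ∷ R` does not expose; hence the list is
  -- abstracted along with an equation, and `body` restates the `with` clause.
  go : ∀ π → π ≡ L ++ m ∷ R → sFuel (suc f) π ≡ sFuel f L ++ sFuel f R ++ [ m ]
  go []       eq = contradiction (trans (cong length eq) (length-middle L m R)) 0≢1+n
  go (x ∷ xs) eq =
    trans (cong (λ π → body (maxL π) (splitAtVal (maxL π) π)) eq)
    (trans (cong (λ v → body v (splitAtVal v (L ++ m ∷ R))) (maxL-middle L<m R<m))
    (cong (body m) (splitAtVal-middle L R (All.map <⇒≢ L<m))))

-- Inside `s (L ++ m ∷ R)` the recursive calls receive fuel `length L + length R`, whereas `s L` and
-- `s R` start from their own lengths, so sufficient fuel must be shown interchangeable.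
sFuel-stable : ∀ {σ} → DecTree σ → ∀ {f} → length σ ≤ f → sFuel f σ ≡ s σ
sFuel-stable leaf _ = refl
sFuel-stable (node {L} {m} {R} tL tR L<m R<m) {f} le with length (L ++ m ∷ R) | length-middle L m R
sFuel-stable (node {L} {m} {R} tL tR L<m R<m) {suc f} (s≤s le) | _ | refl =
  trans (sFuel-middle f L<m R<m)
  (trans (cong₂ (λ u v → u ++ v ++ [ m ])
    (trans (sFuel-stable tL (≤-trans (m≤m+n _ _) le)) (sym (sFuel-stable tL (m≤m+n _ _))))
    (trans (sFuel-stable tR (≤-trans (m≤n+m _ _) le)) (sym (sFuel-stable tR (m≤n+m _ _)))))
  (sym (sFuel-middle (length L + length R) L<m R<m)))

s-node : ∀ {L m R} → DecTree L → DecTree R → All (_< m) L → All (_< m) R →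
  s (L ++ m ∷ R) ≡ s L ++ s R ++ [ m ]
s-node {L} {m} {R} tL tR L<m R<m =
  trans (cong (λ k → sFuel k (L ++ m ∷ R)) (length-middle L m R))
  (trans (sFuel-middle (length L + length R) L<m R<m)
  (cong₂ (λ u v → u ++ v ++ [ m ]) (sFuel-stable tL (m≤m+n _ _)) (sFuel-stable tR (m≤n+m _ _))))

s-↭ : ∀ {σ} → DecTree σ → s σ ↭ σ
s-↭ leaf = ↭-refl
s-↭ (node {L} {m} {R} tL tR L<m R<m) rewrite s-node tL tR L<m R<m =
  Perm.++⁺ (s-↭ tL) (↭-trans (↭-sym (Perm.∷↭∷ʳ m (s R))) (prep m (s-↭ tR)))

-- Tight preimages

NoPeak : List ℕ → Set
NoPeak π = ∀ {a b c} → (a ∷ b ∷ c ∷ []) ⊆ π → a < b → ¬ c < b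

NoPeak-⊆ : ∀ {π ρ} → ρ ⊆ π → NoPeak π → NoPeak ρ
NoPeak-⊆ ρ⊆π np p = np (⊆-trans p ρ⊆π)

-- As a tree: every inner vertex `a` has two children, the left one a leaf `d`. Since `s` keeps the
-- head `h` of a tight list in front, `h < d` makes the step from the left leaf to the right subtree
-- a descent of the image.
data Tight : List ℕ → Set where
  one : ∀ {c} → Tight [ c ]
  two : ∀ {d a h t} → Tight (h ∷ t) → h < d → d < a → All (_< a) (h ∷ t) → Tight (d ∷ a ∷ h ∷ t)

singleton : ∀ c → DecTree [ c ]
singleton c = node leaf leaf [] []

s-singleton : ∀ c → s [ c ] ≡ [ c ]
s-singleton c = s-node leaf leaf [] []

tight-tree : ∀ {σ} → Tight σ → DecTree σ
tight-tree one = singleton _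
tight-tree (two t h<d d<a lt) = node (singleton _) (tight-tree t) (d<a ∷ []) lt

s-two : ∀ {d a h t} → Tight (h ∷ t) → d < a → All (_< a) (h ∷ t) →
  s (d ∷ a ∷ h ∷ t) ≡ d ∷ s (h ∷ t) ++ [ a ]
s-two {d} {a} {h} {t} T d<a lt =
  trans (s-node (singleton d) (tight-tree T) (d<a ∷ []) lt) (cong (_++ s (h ∷ t) ++ [ a ]) (s-singleton d))

s-head : ∀ {h t} → Tight (h ∷ t) → ∃ λ r → s (h ∷ t) ≡ h ∷ r
s-head (one {c}) = [] , s-singleton c
s-head (two T _ d<a lt) = _ , s-two T d<a lt

s-All : ∀ {P : ℕ → Set} {σ} → DecTree σ → All P σ → All P (s σ)
s-All t = Perm.All-resp-↭ (↭-sym (s-↭ t))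

All-s : ∀ {P : ℕ → Set} {σ} → DecTree σ → All P (s σ) → All P σ
All-s t = Perm.All-resp-↭ (s-↭ t)

Alternative : List ℕ → Set
Alternative σ = ∃ λ σ′ → σ′ ≢ σ × DecTree σ′ × s σ′ ≡ s σ

Unique-disjoint : ∀ (L : List ℕ) {m R x y} → Unique (L ++ m ∷ R) → x ∈ L → y ∈ R → x ≢ y
Unique-disjoint (z ∷ L) (z≢ ∷ u) (here refl) y∈ = All.lookup z≢ (∈-++⁺ʳ L (there y∈))
Unique-disjoint (z ∷ L) (z≢ ∷ u) (there x∈) y∈ = Unique-disjoint L u x∈ y∈

alternative-left : ∀ {L m R} → Alternative L → DecTree L → DecTree R → All (_< m) L → All (_< m) R →
  Alternative (L ++ m ∷ R)
alternative-left {L} {m} {R} (L′ , L′≢L , tL′ , eq) tL tR L<m R<m =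
  L′ ++ m ∷ R , L′≢L ∘ ++-cancelʳ (m ∷ R) L′ L , node tL′ tR L′<m R<m ,
  trans (s-node tL′ tR L′<m R<m) (trans (cong (_++ s R ++ [ m ]) eq) (sym (s-node tL tR L<m R<m)))
  where
  L′<m = All-s tL′ (subst (All (_< m)) (sym eq) (s-All tL L<m))

alternative-right : ∀ {L m R} → Alternative R → DecTree L → DecTree R → All (_< m) L → All (_< m) R →
  Alternative (L ++ m ∷ R)
alternative-right {L} {m} {R} (R′ , R′≢R , tR′ , eq) tL tR L<m R<m =
  L ++ m ∷ R′ , R′≢R ∘ ∷-injectiveʳ ∘ ++-cancelˡ L _ _ , node tL tR′ L<m R′<m ,
  trans (s-node tL tR′ L<m R′<m) (trans (cong (λ z → s L ++ z ++ [ m ]) eq) (sym (s-node tL tR L<m R<m)))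
  where
  R′<m = All-s tR′ (subst (All (_< m)) (sym eq) (s-All tR R<m))

alternative-emptyˡ : ∀ {m h t} → DecTree (h ∷ t) → All (_< m) (h ∷ t) → Alternative (m ∷ h ∷ t)
alternative-emptyˡ {m} {h} {t} tR R<m@(h<m ∷ _) =
  h ∷ t ++ [ m ] , (λ eq → <⇒≢ h<m (∷-injectiveˡ eq)) , node tR leaf R<m [] ,
  trans (s-node tR leaf R<m []) (sym (s-node leaf tR [] R<m))

alternative-emptyʳ : ∀ {m h t} → DecTree (h ∷ t) → All (_< m) (h ∷ t) → Alternative (h ∷ t ++ [ m ])
alternative-emptyʳ {m} {h} {t} tL L<m@(h<m ∷ _) =
  m ∷ h ∷ t , (λ eq → <⇒≢ h<m (sym (∷-injectiveˡ eq))) , node leaf tL [] L<m ,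
  trans (s-node leaf tL [] L<m) (sym (s-node tL leaf L<m []))

-- If `r` exceeds all of `L`, the right leaf `r` can be moved between `L` and `m`, becoming the root
-- above `L`; post-order reads `s L`, `r`, `m` either way.
alternative-single : ∀ {L m r} → DecTree L → All (_< r) L → r < m → All (_< m) L →
    Alternative (L ++ m ∷ r ∷ [])
alternative-single {L} {m} {r} tL L<r r<m L<m =
  (L ++ [ r ]) ++ [ m ] , neq , node tLr leaf Lr<m [] ,
  trans (s-node tLr leaf Lr<m [])
  (trans (cong (_++ [ m ]) (s-node tL leaf L<r []))
  (trans (++-assoc (s L) [ r ] [ m ])
  (trans (cong (λ z → s L ++ z ++ [ m ]) (sym (s-singleton r)))
  (sym (s-node tL (singleton r) L<m (r<m ∷ []))))))
  where
  tLr = node tL leaf L<r []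
  Lr<m = All.++⁺ L<m (r<m ∷ [])
  neq : (L ++ [ r ]) ++ [ m ] ≢ L ++ m ∷ r ∷ []
  neq eq = <⇒≢ r<m (∷-injectiveˡ (++-cancelˡ L _ _ (trans (sym (++-assoc L [ r ] [ m ])) eq)))

head-⊆ : ∀ {h t} → Tight (h ∷ t) → h ∷ [] ⊆ s (h ∷ t)
head-⊆ {h} T = subst (h ∷ [] ⊆_) (sym (proj₂ (s-head T))) (refl ∷ minimum _)

descent-⊆ : ∀ {d a h t} → Tight (h ∷ t) → d < a → All (_< a) (h ∷ t) → d ∷ h ∷ [] ⊆ s (d ∷ a ∷ h ∷ t)
descent-⊆ {d} {a} {h} T d<a lt =
  subst (d ∷ h ∷ [] ⊆_) (sym (s-two T d<a lt)) (refl ∷ ++⁺ʳ [ a ] (head-⊆ T))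

ascent-⊆ : ∀ {d a h t} → Tight (h ∷ t) → d < a → All (_< a) (h ∷ t) → d ∷ a ∷ [] ⊆ s (d ∷ a ∷ h ∷ t)
ascent-⊆ {d} {a} {h} {t} T d<a lt =
  subst (d ∷ a ∷ [] ⊆_) (sym (s-two T d<a lt)) (refl ∷ ++⁺ˡ (s (h ∷ t)) ⊆-refl)

-- What resists the moves on single children is a vertex with two tight subtrees. If `L` has more
-- than one entry, `s L` ascends to its maximum `a`, so without a peak the head of `R` lies above
-- `a`; a descent in `s R` would then complete a peak, so `R` is one entry and `alternative-single`
-- applies. If `L` is a single `d`, the same reasoning applies when the head of `R` exceeds `d`;
-- otherwise the vertex is tight.
dichotomy : ∀ {σ} → DecTree σ → Unique σ → NoPeak (s σ) → σ ≡ [] ⊎ Tight σ ⊎ Alternative σ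
dichotomy leaf u np = inj₁ refl
dichotomy (node {L} {m} {R} tL tR L<m R<m) u np =
  inj₂ (go (dichotomy tL (Unique-left L u) npL) (dichotomy tR (Unique-right L u) npR))
  where
  npLR : NoPeak (s L ++ s R ++ [ m ])
  npLR = subst NoPeak (s-node tL tR L<m R<m) np
  npL : NoPeak (s L)
  npL = NoPeak-⊆ (++⁺ʳ _ ⊆-refl) npLR
  npR : NoPeak (s R)
  npR = NoPeak-⊆ (++⁺ˡ (s L) (++⁺ʳ _ ⊆-refl)) npLR
  distinct : ∀ {x y} → x ∈ L → y ∈ R → x ≢ y
  distinct = Unique-disjoint L u
  -- A peak across the junction has its top in `s R` (`peak₁`) or in `s L` (`peak₂`).
  peak₁ : ∀ {a b c} → a ∷ [] ⊆ s L → b ∷ c ∷ [] ⊆ s R → a < b → ¬ c < b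
  peak₁ p q = npLR (++⁺ p (++⁺ʳ [ m ] q))
  peak₂ : ∀ {a b c} → a ∷ b ∷ [] ⊆ s L → c ∷ [] ⊆ s R → a < b → ¬ c < b
  peak₂ p q = npLR (++⁺ p (++⁺ʳ [ m ] q))

  go : L ≡ [] ⊎ Tight L ⊎ Alternative L → R ≡ [] ⊎ Tight R ⊎ Alternative R →
       Tight (L ++ m ∷ R) ⊎ Alternative (L ++ m ∷ R)
  go (inj₂ (inj₂ alt)) _ = inj₂ (alternative-left alt tL tR L<m R<m)
  go _ (inj₂ (inj₂ alt)) = inj₂ (alternative-right {L} alt tL tR L<m R<m)
  go (inj₁ refl) (inj₁ refl) = inj₁ one
  go (inj₁ refl) (inj₂ (inj₁ one)) = inj₂ (alternative-emptyˡ tR R<m)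
  go (inj₁ refl) (inj₂ (inj₁ (two _ _ _ _))) = inj₂ (alternative-emptyˡ tR R<m)
  go (inj₂ (inj₁ one)) (inj₁ refl) = inj₂ (alternative-emptyʳ tL L<m)
  go (inj₂ (inj₁ (two _ _ _ _))) (inj₁ refl) = inj₂ (alternative-emptyʳ tL L<m)
  go (inj₂ (inj₁ (one {d}))) (inj₂ (inj₁ (one {r}))) with <-cmp d r
  ... | tri< d<r _ _ = inj₂ (alternative-single tL (d<r ∷ []) (All.head R<m) L<m)
  ... | tri≈ _ d≡r _ = contradiction d≡r (distinct (here refl) (here refl))
  ... | tri> _ _ r<d = inj₁ (two one r<d (All.head L<m) R<m)
  go (inj₂ (inj₁ (one {d}))) (inj₂ (inj₁ T@(two {d′} T′ h′<d′ d′<a′ lt))) with <-cmp d d′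
  ... | tri< d<d′ _ _ = contradiction h′<d′ (peak₁ (head-⊆ (one {d})) (descent-⊆ T′ d′<a′ lt) d<d′)
  ... | tri≈ _ d≡d′ _ = contradiction d≡d′ (distinct (here refl) (here refl))
  ... | tri> _ _ d′<d = inj₁ (two T d′<d (All.head L<m) R<m)
  go (inj₂ (inj₁ (two {d} {a} T h<d d<a lt))) (inj₂ (inj₁ (one {r}))) with <-cmp a r
  ... | tri< a<r _ _ = inj₂ (alternative-single tL (<-trans d<a a<r ∷ a<r ∷ All.map (λ p → <-trans p a<r) lt)
                               (All.head R<m) L<m)
  ... | tri≈ _ a≡r _ = contradiction a≡r (distinct (there (here refl)) (here refl))
  ... | tri> _ _ r<a = contradiction r<a (peak₂ (ascent-⊆ T d<a lt) (head-⊆ (one {r})) d<a)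
  go (inj₂ (inj₁ (two {d} {a} T h<d d<a lt))) (inj₂ (inj₁ T″@(two {d′} T′ h′<d′ d′<a′ lt′))) with <-cmp a d′
  ... | tri< a<d′ _ _ = contradiction h′<d′
          (peak₁ (⊆-trans (d ∷ʳ ⊆-refl) (ascent-⊆ T d<a lt)) (descent-⊆ T′ d′<a′ lt′) a<d′)
  ... | tri≈ _ a≡d′ _ = contradiction a≡d′ (distinct (there (here refl)) (here refl))
  ... | tri> _ _ d′<a = contradiction d′<a (peak₂ (ascent-⊆ T d<a lt) (head-⊆ T″) d<a)

-- Descents of sorted permutations

drop? : ℕ → ℕ → ℕ
drop? x y = if y <ᵇ x then 1 else 0

des : List ℕ → ℕ
des []           = 0
des (x ∷ [])     = 0
des (x ∷ y ∷ zs) = drop? x y + des (y ∷ zs)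

drop?≤1 : ∀ x y → drop? x y ≤ 1
drop?≤1 x y with y <ᵇ x
... | true  = ≤-refl
... | false = z≤n

drop?-> : ∀ {x y} → y < x → drop? x y ≡ 1
drop?-> {x} {y} y<x with y <ᵇ x | <⇒<ᵇ y<x
... | true | _ = refl

drop?-≤ : ∀ {x y} → x ≤ y → drop? x y ≡ 0
drop?-≤ {x} {y} x≤y with y <ᵇ x in eq
... | true  = contradiction (<ᵇ⇒< y x (subst T (sym eq) tt)) (≤⇒≯ x≤y)
... | false = refl

des-split : ∀ xs y ys → des (xs ++ y ∷ ys) ≡ des (xs ++ [ y ]) + des (y ∷ ys)
des-split []            y ys = refl
des-split (x ∷ [])      y ys = cong (_+ des (y ∷ ys)) (sym (+-identityʳ (drop? x y)))
des-split (x ∷ x′ ∷ xs) y ys =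
  trans (cong (drop? x x′ +_) (des-split (x′ ∷ xs) y ys)) (sym (+-assoc (drop? x x′) _ _))

des-snoc-≤ : ∀ xs y → des (xs ++ [ y ]) ≤ suc (des xs)
des-snoc-≤ []            y = z≤n
des-snoc-≤ (x ∷ [])      y = ≤-trans (≤-reflexive (+-identityʳ _)) (drop?≤1 x y)
des-snoc-≤ (x ∷ x′ ∷ xs) y =
  ≤-trans (+-monoʳ-≤ (drop? x x′) (des-snoc-≤ (x′ ∷ xs) y)) (≤-reflexive (+-suc (drop? x x′) _))

des-snoc-max : ∀ xs {y} → All (_≤ y) xs → des (xs ++ [ y ]) ≡ des xs
des-snoc-max []             []        = refl
des-snoc-max (x ∷ [])       (x≤y ∷ _) = trans (+-identityʳ _) (drop?-≤ x≤y)
des-snoc-max (x ∷ x′ ∷ xs) (_ ∷ p)   = cong (drop? x x′ +_) (des-snoc-max (x′ ∷ xs) p)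

-- Truncated subtraction: the bound reads 2 des ≤ length - 1 on nonempty lists and 0 ≤ 0 on [].
Sparse : List ℕ → Set
Sparse xs = 2 * des xs ≤ length xs ∸ 1

-- The junction of two nonempty lists adds at most one descent, which costs two and is paid for by
-- one unit of slack on each side. The maximum that `s` appends afterwards adds length but no
-- descent, restoring the slack.
sparse-++ : ∀ xs ys → Sparse xs → Sparse ys → 2 * des (xs ++ ys) ≤ length xs + length ys
sparse-++ []         ys       p q = ≤-trans q (m∸n≤m _ 1)
sparse-++ (x ∷ xs) []        p q rewrite ++-identityʳ xs | +-identityʳ (length xs) = ≤-trans p (n≤1+n _)
sparse-++ (x ∷ xs) (y ∷ ys) p q = begin
  2 * des (x ∷ xs ++ y ∷ ys)                     ≡⟨ cong (2 *_) (des-split (x ∷ xs) y ys) ⟩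
  2 * (des (x ∷ xs ++ [ y ]) + des (y ∷ ys))     ≤⟨ *-monoʳ-≤ 2 (+-monoˡ-≤ _ (des-snoc-≤ (x ∷ xs) y)) ⟩
  2 * (suc (des (x ∷ xs)) + des (y ∷ ys))        ≡⟨ arith (des (x ∷ xs)) (des (y ∷ ys)) ⟩
  suc (2 * des (x ∷ xs)) + suc (2 * des (y ∷ ys)) ≤⟨ +-mono-≤ (s≤s p) (s≤s q) ⟩
  length (x ∷ xs) + length (y ∷ ys)               ∎
  where
  open ≤-Reasoning
  arith : ∀ a b → 2 * (suc a + b) ≡ suc (2 * a) + suc (2 * b)
  arith = solve-∀

s-sparse : ∀ {σ} → DecTree σ → Sparse (s σ)
s-sparse leaf = z≤n
s-sparse (node {L} {m} {R} tL tR L<m R<m) = subst Sparse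
    (sym (trans (s-node tL tR L<m R<m) (sym (++-assoc (s L) (s R) [ m ])))) (begin
  2 * des ((s L ++ s R) ++ [ m ])        ≡⟨ cong (2 *_)
      (des-snoc-max (s L ++ s R) (All.map <⇒≤ (All.++⁺ (s-All tL L<m) (s-All tR R<m)))) ⟩
  2 * des (s L ++ s R)                   ≤⟨ sparse-++ (s L) (s R) (s-sparse tL) (s-sparse tR) ⟩
  length (s L) + length (s R)            ≡⟨ sym
      (cong (_∸ 1) (trans (length-middle (s L ++ s R) m [])
      (cong suc (trans (+-identityʳ _) (length-++ (s L)))))) ⟩
  length ((s L ++ s R) ++ [ m ]) ∸ 1     ∎)
  where open ≤-Reasoning

des-s-two : ∀ {d h r a} → h < d → All (_< a) (h ∷ r) → d < a → des (d ∷ (h ∷ r) ++ [ a ]) ≡ suc (des (h ∷ r))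
des-s-two h<d lt d<a rewrite drop?-> h<d = cong suc (des-snoc-max _ (All.map <⇒≤ lt))

-- Each layer `two` contributes two entries and exactly one descent, from `d` to `h`.
tight-length : ∀ {σ} → Tight σ → suc (2 * des (s σ)) ≡ length σ
tight-length (one {c}) rewrite s-singleton c = refl
tight-length (two {d} {a} {h} {t} T h<d d<a lt) with s-head T
... | r , eq = trans (cong (λ π → suc (2 * des π)) (trans (s-two T d<a lt) (cong (λ z → d ∷ z ++ [ a ]) eq)))
  (trans (cong (λ z → suc (2 * z)) (des-s-two h<d (subst (All (_< a)) eq (s-All (tight-tree T) lt)) d<a))
  (trans (arith (des (h ∷ r))) (cong (2 +_) (trans (cong (λ z → suc (2 * des z)) (sym eq))
      (tight-length T)))))
  where
  arith : ∀ x → suc (2 * suc x) ≡ 2 + suc (2 * x)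
  arith = solve-∀

s-length : ∀ {σ} → DecTree σ → length (s σ) ≡ length σ
s-length t = Perm.↭-length (s-↭ t)

-- One above the bound of `Sparse` on a nonempty list. This is what is left of a tight image after
-- deleting its final maximum, which belongs to no descent (`saturated-cons`).
Saturated : List ℕ → Set
Saturated xs = 2 * des xs ≡ length xs

¬saturated-sparse : ∀ {x xs} → Saturated (x ∷ xs) → ¬ Sparse (x ∷ xs)
¬saturated-sparse {xs = xs} sat sp = <-irrefl refl (≤-trans (≤-reflexive (sym sat)) sp)

s-last : ∀ {σ x x′ xs} → DecTree σ → s σ ≡ x ∷ x′ ∷ xs →
  ∃₂ λ ys m → x ∷ x′ ∷ xs ≡ (x ∷ ys) ++ [ m ] × All (_< m) (x ∷ ys)
s-last (node {L} {m} {R} tL tR L<m R<m) eq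
  with s L ++ s R | All.++⁺ (s-All tL L<m) (s-All tR R<m)
     | trans (++-assoc (s L) (s R) [ m ]) (trans (sym (s-node tL tR L<m R<m)) eq)
... | []     | _  | ()
... | x ∷ ys | lt | e with ∷-injectiveˡ e
... | refl = ys , m , sym e , lt

-- A decomposition s L ++ s R of a saturated peakless list must cut after the first entry:
-- otherwise s L ends with an ascent, and then the junction is not a descent.
module _ {d r} (sat : Saturated (d ∷ r)) (np : NoPeak (d ∷ r)) where

  first-cut : ∀ {L R} → DecTree L → DecTree R → s L ++ s R ≡ d ∷ r → L ≡ [ d ] × s R ≡ r
  first-cut {L} {R} tL tR eq with s L in eL | s R in eR
  -- With one side empty the whole saturated list would be the image of the other side, against
  -- `Sparse`.
  first-cut {L} {R} tL tR eq | [] | yR =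
    contradiction (subst Sparse (trans eR eq) (s-sparse tR)) (¬saturated-sparse {d} {r} sat)
  first-cut {L} {R} tL tR refl | x ∷ [] | yR =
    Perm.↭-singleton-inv (↭-trans (↭-sym (s-↭ tL)) (↭-reflexive eL)) , refl
  first-cut {L} {R} tL tR eq | x ∷ x′ ∷ xs | [] =
    contradiction (subst Sparse (trans eL (trans (sym (++-identityʳ _)) eq)) (s-sparse tL))
        (¬saturated-sparse {d} {r} sat)
  first-cut {L} {R} tL tR eq | x ∷ x′ ∷ xs | y ∷ ys =
      contradiction bound (<⇒≱ (+-mono-<-≤ (n<1+n (suc (length xs))) (n≤1+n (length ys))))
    where
    open ≤-Reasoning
    ascending : All (_≤ y) (x ∷ x′ ∷ xs)
    ascending with s-last tL eL
    ... | zs , m , eq′ , x<m ∷ zs<m = subst (All (_≤ y)) (sym eq′)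
        (All.++⁺ (All.map (λ p → ≤-trans (<⇒≤ p) m≤y) (x<m ∷ zs<m)) (m≤y ∷ []))
      where
      m≤y : m ≤ y
      m≤y = ≮⇒≥ (np (subst (x ∷ m ∷ y ∷ [] ⊆_) (trans (sym (++-assoc (x ∷ zs) [ m ] (y ∷ ys)))
          (trans (cong (_++ y ∷ ys) (sym eq′)) eq))
                   (refl ∷ ++⁺ˡ zs (refl ∷ refl ∷ minimum ys))) x<m)
    arith : ∀ a b → 2 * (a + b) ≡ 2 * a + 2 * b
    arith = solve-∀
    -- With no descent at the junction the slack of both sides survives, so the saturated list would
    -- fall two short of its own length.
    bound : suc (suc (length xs)) + suc (length ys) ≤ suc (length xs) + length ys
    bound = begin
      length (x ∷ x′ ∷ xs) + length (y ∷ ys)             ≡⟨ sym (length-++ (x ∷ x′ ∷ xs)) ⟩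
      length ((x ∷ x′ ∷ xs) ++ y ∷ ys)                   ≡⟨ cong length eq ⟩
      length (d ∷ r)                                      ≡⟨ sym sat ⟩
      2 * des (d ∷ r)                                     ≡⟨ cong (λ z → 2 * des z) (sym eq) ⟩
      2 * des ((x ∷ x′ ∷ xs) ++ y ∷ ys)                  ≡⟨ cong (2 *_) (des-split (x ∷ x′ ∷ xs) y ys) ⟩
      2 * (des (x ∷ x′ ∷ xs ++ [ y ]) + des (y ∷ ys))
          ≡⟨ cong (λ z → 2 * (z + des (y ∷ ys))) (des-snoc-max (x ∷ x′ ∷ xs) ascending) ⟩
      2 * (des (x ∷ x′ ∷ xs) + des (y ∷ ys))             ≡⟨ arith (des (x ∷ x′ ∷ xs)) (des (y ∷ ys)) ⟩
      2 * des (x ∷ x′ ∷ xs) + 2 * des (y ∷ ys)           ≤⟨ +-mono-≤ (subst Sparse eL (s-sparse tL))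
          (subst Sparse eR (s-sparse tR)) ⟩
      suc (length xs) + length ys                          ∎

saturated-cons : ∀ {d h t} → Tight (h ∷ t) → h < d → Saturated (d ∷ s (h ∷ t))
saturated-cons {d} {h} {t} T h<d with s (h ∷ t) | s-head T | tight-length T | s-length (tight-tree T)
... | _ | r , refl | len | len′ rewrite drop?-> h<d = trans (arith (des (h ∷ r)))
    (cong suc (trans len (sym len′)))
  where
  arith : ∀ x → 2 * suc x ≡ suc (suc (2 * x))
  arith = solve-∀

-- The last entry of the image is the root of any preimage, and `first-cut` leaves a single way to
-- divide the rest; the left part is then a leaf and induction settles the right one.
tight-unique : ∀ {σ σ′} → Tight σ → NoPeak (s σ) → DecTree σ′ → s σ′ ≡ s σ → σ′ ≡ σ
tight-unique {σ} {σ′} (one {c}) np tree eq =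
  Perm.↭-singleton-inv (↭-trans (↭-sym (s-↭ tree)) (↭-reflexive (trans eq (s-singleton c))))
tight-unique (two {d} {a} {h} {t} T h<d d<a lt) np leaf eq = contradiction (trans eq (s-two T d<a lt)) λ ()
tight-unique (two {d} {a} {h} {t} T h<d d<a lt) np (node {L} {m} {R} tL tR L<m R<m) eq
  with ∷ʳ-injective (s L ++ s R) (d ∷ s (h ∷ t))
         (trans (++-assoc (s L) (s R) [ m ]) (trans (sym (s-node tL tR L<m R<m)) (trans eq (s-two T d<a lt))))
... | eq′ , refl with first-cut (saturated-cons T h<d)
         (NoPeak-⊆ (++⁺ʳ [ a ] ⊆-refl) (subst NoPeak (s-two T d<a lt) np)) tL tR eq′
... | refl , eqR = cong (λ z → d ∷ a ∷ z) (tight-unique T npR tR eqR)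
  where
  npR : NoPeak (s (h ∷ t))
  npR = NoPeak-⊆ (d ∷ʳ ++⁺ʳ [ a ] ⊆-refl) (subst NoPeak (s-two T d<a lt) np)

-- Valley permutations and Dyck words

range1-suc : ∀ n → range1 (suc n) ≡ range1 n ++ [ suc n ]
range1-suc n = trans (cong (map suc) (sym (upTo-∷ʳ n))) (map-++ suc (upTo n) [ n ])

length-range1 : ∀ n → length (range1 n) ≡ n
length-range1 n = trans (length-map suc (upTo n)) (length-upTo n)

range1-unique : ∀ n → Unique (range1 n)
range1-unique n = Uniq.map⁺ suc-injective (Uniq.upTo⁺ n)

range1-≤ : ∀ n → All (_≤ n) (range1 n)
range1-≤ n = All.map⁺ (All.all-upTo n)

Unique-↭ : {xs ys : List ℕ} → xs ↭ ys → Unique xs → Unique ys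
Unique-↭ p = Permₛ.Unique-resp-↭ (↭⇒↭ₛ p)

IsPerm-unique : ∀ {n π} → IsPerm n π → Unique π
IsPerm-unique {n} p = Unique-↭ (↭-sym p) (range1-unique n)

IsPerm-length : ∀ {n π} → IsPerm n π → length π ≡ n
IsPerm-length {n} p = trans (Perm.↭-length p) (length-range1 n)

-- The permutations of [1 + length w] without a peak: the letters of w, read from the left, say on
-- which side of the entry 1 the values from the largest down to 2 lie (D on the left, U on the right).
valley : List Step → List ℕ
valley []      = [ 1 ]
valley (U ∷ w) = valley w ++ [ 2 + length w ]
valley (D ∷ w) = 2 + length w ∷ valley w

valley-↭ : ∀ w → IsPerm (suc (length w)) (valley w)
valley-↭ []      = ↭-refl
valley-↭ (U ∷ w) = ↭-trans (Perm.++⁺ʳ _ (valley-↭ w)) (↭-reflexive (sym (range1-suc _)))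
valley-↭ (D ∷ w) = ↭-trans (prep _ (valley-↭ w)) (↭-trans (Perm.∷↭∷ʳ _ _) (↭-reflexive (sym (range1-suc _))))

IsPerm-≤ : ∀ {n π} → IsPerm n π → All (_≤ n) π
IsPerm-≤ {n} p = Perm.All-resp-↭ (↭-sym p) (range1-≤ n)

NoPeak-cons-max : ∀ {n xs} → All (_< n) xs → NoPeak xs → NoPeak (n ∷ xs)
NoPeak-cons-max lt np (_ ∷ʳ p)    a<b c<b = np p a<b c<b
NoPeak-cons-max lt np (refl ∷ p) n<b c<b with All-resp-⊆ p lt
... | b<n ∷ _ = <-asym n<b b<n

⊆-snoc : ∀ ys {xs} {n : ℕ} → xs ⊆ ys ++ [ n ] → xs ⊆ ys ⊎ ∃ λ zs → xs ≡ zs ++ [ n ] × zs ⊆ ys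
⊆-snoc []       (_ ∷ʳ [])    = inj₁ []
⊆-snoc []       (refl ∷ []) = inj₂ ([] , refl , [])
⊆-snoc (y ∷ ys) (_ ∷ʳ p) with ⊆-snoc ys p
... | inj₁ q              = inj₁ (y ∷ʳ q)
... | inj₂ (zs , refl , q) = inj₂ (zs , refl , y ∷ʳ q)
⊆-snoc (y ∷ ys) (refl ∷ p) with ⊆-snoc ys p
... | inj₁ q              = inj₁ (refl ∷ q)
... | inj₂ (zs , refl , q) = inj₂ (y ∷ zs , refl , refl ∷ q)

NoPeak-snoc-max : ∀ {n xs} → All (_< n) xs → NoPeak xs → NoPeak (xs ++ [ n ])
NoPeak-snoc-max {n} {xs} lt np {a} {b} {c} p a<b c<b with ⊆-snoc xs p
... | inj₁ q = np q a<b c<b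
... | inj₂ (zs , eq , q) with ∷ʳ-injective (a ∷ b ∷ []) zs eq
... | refl , refl with All-resp-⊆ q lt
... | _ ∷ b<n ∷ [] = <-asym c<b b<n

valley-NoPeak : ∀ w → NoPeak (valley w)
valley-NoPeak []      (_ ∷ʳ ())
valley-NoPeak []      (refl ∷ ())
valley-NoPeak (U ∷ w) = NoPeak-snoc-max (All.map s≤s (IsPerm-≤ (valley-↭ w))) (valley-NoPeak w)
valley-NoPeak (D ∷ w) = NoPeak-cons-max (All.map s≤s (IsPerm-≤ (valley-↭ w))) (valley-NoPeak w)

-- An inner maximum would be the top of a peak, so the maximum stands at an end; that end is the
-- first letter, and deleting the maximum keeps the list peakless.
NoPeak⇒valley : ∀ m {π} → IsPerm (suc m) π → NoPeak π → ∃ λ w → length w ≡ m × π ≡ valley w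
NoPeak⇒valley zero    p np = [] , refl , Perm.↭-singleton-inv p
NoPeak⇒valley (suc m) {π} p np
  with ∈-∃++ (Perm.∈-resp-↭ (↭-sym p) (subst (2 + m ∈_) (sym (range1-suc (suc m)))
      (∈-++⁺ʳ (range1 (suc m)) (here refl))))
... | L , R , refl = go L R (↭-trans (Perm.drop-mid L (range1 (suc m))
    (↭-trans p (↭-reflexive (range1-suc (suc m))))) (↭-reflexive (++-identityʳ _))) np
  where
  go : ∀ L R → IsPerm (suc m) (L ++ R) → NoPeak (L ++ 2 + m ∷ R) → ∃ λ w →
      length w ≡ suc m × L ++ 2 + m ∷ R ≡ valley w
  go [] R q np with NoPeak⇒valley m q (NoPeak-⊆ (_ ∷ʳ ⊆-refl) np)
  ... | w , refl , refl = D ∷ w , refl , refl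
  go (x ∷ L) [] q np with NoPeak⇒valley m (↭-trans (↭-reflexive (sym (++-identityʳ _))) q)
      (NoPeak-⊆ (++⁺ʳ _ ⊆-refl) np)
  ... | w , refl , eq = U ∷ w , refl , cong (_++ [ 2 + m ]) eq
  go (x ∷ L) (y ∷ R) q np with IsPerm-≤ q
  ... | x≤ ∷ le = contradiction (s≤s (All.head (All.++⁻ʳ L le)))
                    (np (refl ∷ ++⁺ˡ L (refl ∷ refl ∷ minimum R)) (s≤s x≤))

private
  both : {A B : Set} → A → B → (A → B) × (B → A)
  both a b = (λ _ → b) , (λ _ → a)

  neither : {A B : Set} → ¬ A → ¬ B → (A → B) × (B → A)
  neither ¬a ¬b = (λ a → contradiction a ¬a) , (λ b → contradiction b ¬b)

-- Both forbidden patterns have their top in the middle and differ only in how the outer entries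
-- compare, which the last two hypotheses leave open.
SameOrder-peak : ∀ {a b c a′ b′ c′} → a < b → c < b → a′ < b′ → c′ < b′ →
  (a < c → a′ < c′) × (a′ < c′ → a < c) → (c < a → c′ < a′) × (c′ < a′ → c < a) →
  SameOrder (a ∷ b ∷ c ∷ []) (a′ ∷ b′ ∷ c′ ∷ [])
SameOrder-peak a<b c<b a′<b′ c′<b′ ac ca = refl , λ
  { 1 1 _ _ _ _ → neither (<-irrefl refl) (<-irrefl refl)
  ; 1 2 _ _ _ _ → both a<b a′<b′
  ; 1 3 _ _ _ _ → ac
  ; 2 1 _ _ _ _ → neither (<-asym a<b) (<-asym a′<b′)
  ; 2 2 _ _ _ _ → neither (<-irrefl refl) (<-irrefl refl)
  ; 2 3 _ _ _ _ → neither (<-asym c<b) (<-asym c′<b′)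
  ; 3 1 _ _ _ _ → ca
  ; 3 2 _ _ _ _ → both c<b c′<b′
  ; 3 3 _ _ _ _ → neither (<-irrefl refl) (<-irrefl refl)
  ; (suc (suc (suc (suc _)))) _ _ (s≤s (s≤s (s≤s ()))) _ _
  ; _ (suc (suc (suc (suc _)))) _ _ _ (s≤s (s≤s (s≤s ())))
  }

avoids⇒NoPeak : ∀ {π} → Unique π → Avoids π (1 ∷ 3 ∷ 2 ∷ []) → Avoids π (2 ∷ 3 ∷ 1 ∷ []) → NoPeak π
avoids⇒NoPeak u av₁₃₂ av₂₃₁ {a} {b} {c} p a<b c<b with <-cmp a c
... | tri< a<c _ _ = av₁₃₂ (_ , p , SameOrder-peak a<b c<b (s≤s (s≤s z≤n)) (s≤s (s≤s (s≤s z≤n)))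
        (both a<c (s≤s (s≤s z≤n))) (neither (<-asym a<c) λ { (s≤s ()) }))
... | tri≈ _ a≡c _ with Unique-⊆ p u
...   | (_ ∷ a≢c ∷ []) ∷ _ = a≢c a≡c
avoids⇒NoPeak u av₁₃₂ av₂₃₁ {a} {b} {c} p a<b c<b | tri> _ _ c<a =
  av₂₃₁ (_ , p , SameOrder-peak a<b c<b (s≤s (s≤s (s≤s z≤n))) (s≤s (s≤s z≤n))
        (neither (<-asym c<a) λ { (s≤s ()) }) (both c<a (s≤s (s≤s z≤n))))

NoPeak⇒avoids : ∀ {π a′ b′ c′} → NoPeak π → a′ < b′ → c′ < b′ → Avoids π (a′ ∷ b′ ∷ c′ ∷ [])
NoPeak⇒avoids np a′<b′ c′<b′ (a ∷ b ∷ c ∷ [] , p , _ , so) =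
  np p (proj₂ (so 1 2 (s≤s z≤n) (s≤s z≤n) (s≤s z≤n) (s≤s (s≤s z≤n))) a′<b′)
       (proj₂ (so 3 2 (s≤s z≤n) ≤-refl (s≤s z≤n) (s≤s (s≤s z≤n))) c′<b′)

uniquelySorted⇒tight : ∀ {n π} → IsPerm (suc n) π → NoPeak π → UniquelySorted π → ∃ λ σ → Tight σ × s σ ≡ π
uniquelySorted⇒tight {n} {π} pπ np (σ , pσ , refl , uniq)
  with decTree σ (IsPerm-unique pσ)
... | t with dichotomy t (IsPerm-unique pσ) np
... | inj₁ refl = contradiction (IsPerm-length pπ) λ ()
... | inj₂ (inj₁ T) = σ , T , refl
... | inj₂ (inj₂ (σ′ , σ′≢σ , t′ , eq)) = contradiction (uniq σ′ pσ′ eq) σ′≢σ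
  where
  pσ′ : IsPerm (length (s σ)) σ′
  pσ′ = ↭-trans (↭-sym (s-↭ t′)) (↭-trans (↭-reflexive eq) (↭-trans (s-↭ t) pσ))

tight⇒uniquelySorted : ∀ {n σ} → Tight σ → IsPerm n (s σ) → NoPeak (s σ) → UniquelySorted (s σ)
tight⇒uniquelySorted {n} {σ} T p np =
  σ , ↭-trans (↭-sym (s-↭ (tight-tree T))) p′ , refl ,
  λ σ′ pσ′ eq → tight-unique T np (decTree σ′ (IsPerm-unique pσ′)) eq
  where
  p′ : IsPerm (length (s σ)) (s σ)
  p′ = subst (λ k → IsPerm k (s σ)) (sym (IsPerm-length p)) p

-- Both lists run inwards from the ends of `valley w`, so comparing them entrywise pairs the i-th D
-- with the i-th U, first in, first out.
downs ups : List Step → List ℕ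
downs []      = []
downs (U ∷ w) = downs w
downs (D ∷ w) = 2 + length w ∷ downs w
ups []      = []
ups (U ∷ w) = 2 + length w ∷ ups w
ups (D ∷ w) = ups w

valley-split : ∀ w → valley w ≡ downs w ++ 1 ∷ reverse (ups w)
valley-split []      = refl
valley-split (U ∷ w) rewrite valley-split w | unfold-reverse (2 + length w) (ups w) = ++-assoc (downs w) _ _
valley-split (D ∷ w) = cong (2 + length w ∷_) (valley-split w)

downs-< : ∀ w → All (_< 2 + length w) (downs w)
downs-< []      = []
downs-< (U ∷ w) = All.map m<n⇒m<1+n (downs-< w)
downs-< (D ∷ w) = ≤-refl ∷ All.map m<n⇒m<1+n (downs-< w)

ups-< : ∀ w → All (_< 2 + length w) (ups w)
ups-< []      = []
ups-< (D ∷ w) = All.map m<n⇒m<1+n (ups-< w)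
ups-< (U ∷ w) = ≤-refl ∷ All.map m<n⇒m<1+n (ups-< w)

downs-> : ∀ w → All (1 <_) (downs w)
downs-> []      = []
downs-> (U ∷ w) = downs-> w
downs-> (D ∷ w) = s≤s (s≤s z≤n) ∷ downs-> w

ups-> : ∀ w → All (1 <_) (ups w)
ups-> []      = []
ups-> (D ∷ w) = ups-> w
ups-> (U ∷ w) = s≤s (s≤s z≤n) ∷ ups-> w

downs-decreasing : ∀ w → AllPairs _>_ (downs w)
downs-decreasing []      = []
downs-decreasing (U ∷ w) = downs-decreasing w
downs-decreasing (D ∷ w) = downs-< w ∷ downs-decreasing w

ups-decreasing : ∀ w → AllPairs _>_ (ups w)
ups-decreasing []      = []
ups-decreasing (D ∷ w) = ups-decreasing w
ups-decreasing (U ∷ w) = ups-< w ∷ ups-decreasing w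

record Paired (π : List ℕ) : Set where
  constructor paired
  field
    {left right} : List ℕ
    {centre}     : ℕ
    split        : π ≡ left ++ centre ∷ reverse right
    matched      : Pointwise _<_ left right
    left>        : All (centre <_) left
    right>       : All (centre <_) right

tight⇒paired : ∀ {σ} → Tight σ → Paired (s σ)
tight⇒paired (one {c}) = paired {left = []} {right = []} (s-singleton c) [] [] []
tight⇒paired (two {d} {a} {h} {t} T h<d d<a lt) with tight⇒paired T
... | paired {ds} {us} {c} eq m l> r> = paired {left = d ∷ ds} {right = a ∷ us}
  (trans (s-two T d<a lt) (cong (d ∷_) (trans (cong (_++ [ a ]) eq)
    (trans (++-assoc ds (c ∷ reverse us) [ a ]) (cong (λ z → ds ++ c ∷ z) (sym (unfold-reverse a us)))))))
  (d<a ∷ m) (c<d ∷ l>) (<-trans c<d d<a ∷ r>)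
  where
  -- `h` also heads `s (h ∷ t)`, so it is either the centre or the first entry of the left part.
  c≤h : ∀ {ds} → h ∷ proj₁ (s-head T) ≡ ds ++ c ∷ reverse us → All (c <_) ds → c ≤ h
  c≤h {[]}     e []         = ≤-reflexive (sym (∷-injectiveˡ e))
  c≤h {x ∷ ds} e (c<x ∷ _) = ≤-trans (<⇒≤ c<x) (≤-reflexive (sym (∷-injectiveˡ e)))
  c<d : c < d
  c<d = ≤-<-trans (c≤h (trans (sym (proj₂ (s-head T))) eq) l>) h<d

-- Each centre is the strict minimum of the common list, so both stand at the same place. This
-- identifies the centre of a tight image with the entry 1 of a valley.
middle-injective : ∀ {c c′} ds ds′ {us us′} → ds ++ c ∷ us ≡ ds′ ++ c′ ∷ us′ →
  All (c <_) ds → All (c <_) us → All (c′ <_) ds′ → All (c′ <_) us′ → ds ≡ ds′ × us ≡ us′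
middle-injective [] [] refl _ _ _ _ = refl , refl
middle-injective [] (x ∷ ds′) refl _ c<us (c′<c ∷ _) _ =
  contradiction (All.head (All.++⁻ʳ ds′ c<us)) (<-asym c′<c)
middle-injective (x ∷ ds) [] refl (c<c′ ∷ _) _ _ c′<us =
  contradiction (All.head (All.++⁻ʳ ds c′<us)) (<-asym c<c′)
middle-injective (x ∷ ds) (_ ∷ ds′) eq (_ ∷ p) q (_ ∷ p′) q′ with ∷-injective eq
... | refl , eq′ with middle-injective ds ds′ eq′ p q p′ q′
... | refl , refl = refl , refl

All-reverse : ∀ {P : ℕ → Set} {xs} → All P xs → All P (reverse xs)
All-reverse {xs = xs} = Perm.All-resp-↭ (↭-sym (Perm.↭-reverse xs))

tight⇒matched : ∀ {σ} w → Tight σ → s σ ≡ valley w → Pointwise _<_ (downs w) (ups w)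
tight⇒matched w T eq with tight⇒paired T
... | paired {ds} {us} eq′ m l> r>
  with middle-injective ds (downs w) (trans (sym eq′) (trans eq (valley-split w)))
         l> (All-reverse r>) (downs-> w) (All-reverse (ups-> w))
... | refl , e rewrite reverse-injective {x = us} {y = ups w} e = m

-- The tight preimage built from its image. The last clause discards unpaired entries, but
-- `Pointwise` in `weave-tight` forces equal lengths, so there nothing is lost.
weave : ℕ → List ℕ → List ℕ → List ℕ
weave c (d ∷ ds) (a ∷ us) = d ∷ a ∷ weave c ds us
weave c _        _        = [ c ]

weave-All : ∀ {P : ℕ → Set} {c ds us} → P c → All P ds → All P us → All P (weave c ds us)
weave-All pc []       _         = pc ∷ []
weave-All pc (_ ∷ _) []        = pc ∷ []
weave-All pc (x ∷ p) (y ∷ q) = x ∷ y ∷ weave-All pc p q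

weave-tight : ∀ {c ds us} → Pointwise _<_ ds us → All (c <_) ds → AllPairs _>_ ds → AllPairs _>_ us →
  Tight (weave c ds us) × s (weave c ds us) ≡ ds ++ c ∷ reverse us
weave-tight {c} [] _ _ _ = one , s-singleton c
weave-tight {c} {d ∷ ds} {a ∷ us} (d<a ∷ m) (c<d ∷ c<) (d> ∷ dd) (a> ∷ aa)
  with weave-tight m c< dd aa | weave-All {_< a} (<-trans c<d d<a) (All.map (λ p → <-trans p d<a) d>) a>
... | T , eq | lt = go m c< d> T eq lt
  where
  two′ : ∀ {h t} → h < d → Tight (h ∷ t) → s (h ∷ t) ≡ ds ++ c ∷ reverse us → All (_< a) (h ∷ t) →
    Tight (d ∷ a ∷ h ∷ t) × s (d ∷ a ∷ h ∷ t) ≡ (d ∷ ds) ++ c ∷ reverse (a ∷ us)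
  two′ h<d T eq lt = two T h<d d<a lt , trans (s-two T d<a lt)
    (cong (d ∷_) (trans (cong (_++ [ a ]) eq) (trans (++-assoc ds (c ∷ reverse us) [ a ])
      (cong (λ z → ds ++ c ∷ z) (sym (unfold-reverse a us))))))
  -- The head of the inner `weave` is `c` or the next entry of `ds`; splitting the pairing exposes
  -- which, and either lies below `d`.
  go : Pointwise _<_ ds us → All (c <_) ds → All (_< d) ds → Tight (weave c ds us) →
    s (weave c ds us) ≡ ds ++ c ∷ reverse us → All (_< a) (weave c ds us) →
    Tight (d ∷ a ∷ weave c ds us) × s (d ∷ a ∷ weave c ds us) ≡ (d ∷ ds) ++ c ∷ reverse (a ∷ us)
  go []       _ _            = two′ c<d
  go (_ ∷ _) _ (x<d ∷ _) = two′ x<d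

-- The admissible continuations of a prefix of height `h`: a form that recurses on the word, where
-- `IsDyck` quantifies over its prefixes.
DyckFrom : ℕ → List Step → Set
DyckFrom h       []      = h ≡ 0
DyckFrom h       (U ∷ w) = DyckFrom (suc h) w
DyckFrom zero    (D ∷ w) = ⊥
DyckFrom (suc h) (D ∷ w) = DyckFrom h w

-- The queue ps holds the up-values read so far and not yet matched to a down-value.
matched⇒dyckFrom : ∀ w ps → Pointwise _<_ (downs w) (ps ++ ups w) → DyckFrom (length ps) w
matched⇒dyckFrom []      []       m = refl
matched⇒dyckFrom (U ∷ w) ps m = subst (λ h → DyckFrom h w)
    (trans (length-middle ps _ []) (cong suc (+-identityʳ _)))
  (matched⇒dyckFrom w (ps ++ [ 2 + length w ]) (subst (Pointwise _<_ (downs w))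
      (sym (++-assoc ps _ (ups w))) m))
-- A D that meets an empty queue is paired with a later U, whose value is smaller.
matched⇒dyckFrom (D ∷ w) [] m with ups w | ups-< w
... | _ ∷ _ | u< ∷ _ = case m of λ { (d< ∷ _) → <-asym d< u< }
matched⇒dyckFrom (D ∷ w) (p ∷ ps) (_ ∷ m) = matched⇒dyckFrom w ps m

-- The bound on `ps` says that queued values exceed those of all letters still unread, so the front
-- of a nonempty queue is always a valid partner for D.
dyckFrom⇒matched : ∀ w ps → All (suc (length w) <_) ps → DyckFrom (length ps) w → Pointwise _<_ (downs w)
    (ps ++ ups w)
dyckFrom⇒matched []      []       _ _ = []
dyckFrom⇒matched (U ∷ w) ps p dy = subst (Pointwise _<_ (downs w)) (++-assoc ps _ (ups w))
  (dyckFrom⇒matched w (ps ++ [ 2 + length w ]) (All.++⁺ (All.map (<-trans (n<1+n _)) p) (≤-refl ∷ []))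
    (subst (λ h → DyckFrom h w) (sym (trans (length-middle ps _ []) (cong suc (+-identityʳ _)))) dy))
dyckFrom⇒matched (D ∷ w) (x ∷ ps) (p ∷ p′) dy = p ∷ dyckFrom⇒matched w ps (All.map (<-trans (n<1+n _)) p′) dy

dyckFrom⇒balanced : ∀ h w → DyckFrom h w → #D w ≡ h + #U w
dyckFrom⇒balanced h       []      refl = refl
dyckFrom⇒balanced h       (U ∷ w) dy = trans (dyckFrom⇒balanced (suc h) w dy) (sym (+-suc h _))
dyckFrom⇒balanced (suc h) (D ∷ w) dy = cong suc (dyckFrom⇒balanced h w dy)

dyckFrom⇒prefix : ∀ h p q → DyckFrom h (p ++ q) → #D p ≤ h + #U p
dyckFrom⇒prefix h       []      q dy = z≤n
dyckFrom⇒prefix h       (U ∷ p) q dy = ≤-trans (dyckFrom⇒prefix (suc h) p q dy)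
    (≤-reflexive (sym (+-suc h _)))
dyckFrom⇒prefix (suc h) (D ∷ p) q dy = s≤s (dyckFrom⇒prefix h p q dy)

prefix⇒dyckFrom : ∀ h w → #D w ≡ h + #U w → (∀ p q → p ++ q ≡ w → #D p ≤ h + #U p) → DyckFrom h w
prefix⇒dyckFrom h       []      bal pre = sym (trans bal (+-identityʳ h))
prefix⇒dyckFrom h       (U ∷ w) bal pre = prefix⇒dyckFrom (suc h) w (trans bal (+-suc h _))
  λ p q eq → ≤-trans (pre (U ∷ p) q (cong (U ∷_) eq)) (≤-reflexive (+-suc h _))
prefix⇒dyckFrom zero    (D ∷ w) bal pre = contradiction (pre [ D ] w refl) λ ()
prefix⇒dyckFrom (suc h) (D ∷ w) bal pre = prefix⇒dyckFrom h w (suc-injective bal)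
  λ p q eq → s≤s⁻¹ (pre (D ∷ p) q (cong (D ∷_) eq))

length-#U+#D : ∀ w → length w ≡ #U w + #D w
length-#U+#D []      = refl
length-#U+#D (U ∷ w) = cong suc (length-#U+#D w)
length-#U+#D (D ∷ w) = trans (cong suc (length-#U+#D w)) (sym (+-suc _ _))

isDyck⇒dyckFrom : ∀ {k w} → IsDyck k w → DyckFrom 0 w × length w ≡ 2 * k
isDyck⇒dyckFrom {k} {w} (#U≡k , #D≡k , pre) = prefix⇒dyckFrom 0 w (trans #D≡k (sym #U≡k)) pre ,
  trans (length-#U+#D w) (trans (cong₂ _+_ #U≡k #D≡k) (cong (k +_) (sym (+-identityʳ k))))

dyckFrom⇒isDyck : ∀ {k w} → DyckFrom 0 w → length w ≡ 2 * k → IsDyck k w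
dyckFrom⇒isDyck {k} {w} dy len = #U≡k , trans
    (dyckFrom⇒balanced 0 w dy) #U≡k , λ { p q refl → dyckFrom⇒prefix 0 p q dy }
  where
  #U≡k : #U w ≡ k
  #U≡k = *-cancelˡ-≡ (#U w) k 2 (trans (cong (#U w +_)
      (trans (+-identityʳ _) (sym (dyckFrom⇒balanced 0 w dy)))) (trans (sym (length-#U+#D w)) len))

InU⇒valley : ∀ {k π} → InU132-231 (suc (2 * k)) π → ∃ λ w → IsDyck k w × π ≡ valley w
InU⇒valley {k} (p , us , av₁₃₂ , av₂₃₁) with avoids⇒NoPeak (IsPerm-unique p) av₁₃₂ av₂₃₁
... | np with NoPeak⇒valley _ p np | uniquelySorted⇒tight p np us
... | w , len , refl | σ , T , eq = w , dyckFrom⇒isDyck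
    (matched⇒dyckFrom w [] (tight⇒matched w T eq)) len , refl

valley⇒InU : ∀ {k w} → IsDyck k w → InU132-231 (suc (2 * k)) (valley w)
valley⇒InU {k} {w} dyck with isDyck⇒dyckFrom dyck
... | dy , len with weave-tight (dyckFrom⇒matched w [] [] dy) (downs-> w) (downs-decreasing w)
    (ups-decreasing w)
... | T , eq =
  p , subst UniquelySorted eq′ (tight⇒uniquelySorted T (subst (IsPerm _) (sym eq′) p)
      (subst NoPeak (sym eq′) np)) ,
  NoPeak⇒avoids np (s≤s (s≤s z≤n)) (s≤s (s≤s (s≤s z≤n))) ,
  NoPeak⇒avoids np (s≤s (s≤s (s≤s z≤n))) (s≤s (s≤s z≤n))
  where
  eq′ = trans eq (sym (valley-split w))
  np = valley-NoPeak w
  p : IsPerm (suc (2 * k)) (valley w)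
  p = subst (λ n → IsPerm (suc n) (valley w)) len (valley-↭ w)

-- Inverses and rotation

range1-cons : ∀ n → range1 (suc n) ≡ 1 ∷ map suc (range1 n)
range1-cons n = cong (λ z → 1 ∷ map suc z) (sym (map-upTo suc n))

range1-++ : ∀ a b → range1 (a + b) ≡ range1 a ++ map (a +_) (range1 b)
range1-++ zero    b = sym (map-id (range1 b))
range1-++ (suc a) b = trans (range1-cons (a + b)) (trans
  (cong (1 ∷_) (trans (cong (map suc) (range1-++ a b)) (trans (map-++ suc (range1 a) _)
    (cong (map suc (range1 a) ++_) (sym (map-∘ (range1 b)))))))
  (cong (_++ map (suc a +_) (range1 b)) (sym (range1-cons a))))

range1-≥ : ∀ n → All (1 ≤_) (range1 n)
range1-≥ n = All.map⁺ (All.universal (λ _ → s≤s z≤n) (upTo n))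

∈-range1⁺ : ∀ {n j} → 1 ≤ j → j ≤ n → j ∈ range1 n
∈-range1⁺ {suc n} {j} 1≤j j≤n with m≤n⇒m<n∨m≡n j≤n
... | inj₁ (s≤s j≤n′) = subst (j ∈_) (sym (range1-suc n)) (∈-++⁺ˡ (∈-range1⁺ 1≤j j≤n′))
... | inj₂ refl       = subst (j ∈_) (sym (range1-suc n)) (∈-++⁺ʳ (range1 n) (here refl))
∈-range1⁺ {zero} (s≤s z≤n) ()

IsPerm-≥ : ∀ {n π} → IsPerm n π → All (1 ≤_) π
IsPerm-≥ {n} p = Perm.All-resp-↭ (↭-sym p) (range1-≥ n)

IsPerm-∈ : ∀ {n π j} → IsPerm n π → 1 ≤ j → j ≤ n → j ∈ π
IsPerm-∈ p 1≤j j≤n = Perm.∈-resp-↭ (↭-sym p) (∈-range1⁺ 1≤j j≤n)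

pos-here : ∀ v xs → pos v (v ∷ xs) ≡ 1
pos-here v xs with v ≡ᵇ v in eq
... | true  = refl
... | false = ⊥-elim (subst T eq (≡⇒≡ᵇ v v refl))

pos-there : ∀ {v x} xs → v ≢ x → pos v (x ∷ xs) ≡ suc (pos v xs)
pos-there {v} {x} xs v≢x with v ≡ᵇ x in eq
... | true  = contradiction (≡ᵇ⇒≡ v x (subst T (sym eq) tt)) v≢x
... | false = refl

pos-++ˡ : ∀ {v xs} ys → v ∈ xs → pos v (xs ++ ys) ≡ pos v xs
pos-++ˡ {v} {x ∷ xs} ys v∈ with v ≡ᵇ x in eq
... | true  = refl
pos-++ˡ {v} {x ∷ xs} ys (here refl) | false = ⊥-elim (subst T eq (≡⇒≡ᵇ v v refl))
pos-++ˡ {v} {x ∷ xs} ys (there v∈) | false = cong suc (pos-++ˡ ys v∈)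

pos-++ʳ : ∀ {v xs} ys → All (v ≢_) xs → pos v (xs ++ ys) ≡ length xs + pos v ys
pos-++ʳ ys []          = refl
pos-++ʳ {xs = x ∷ xs} ys (v≢ ∷ p) = trans (pos-there (xs ++ ys) v≢) (cong suc (pos-++ʳ ys p))

pos-map+ : ∀ m v xs → v ∈ xs → pos (m + v) (map (m +_) xs) ≡ pos v xs
pos-map+ m v (x ∷ xs) v∈ with <-cmp v x
... | tri≈ _ refl _ = trans (pos-here (m + v) (map (m +_) xs)) (sym (pos-here v xs))
pos-map+ m v (x ∷ xs) (here refl) | tri< _ v≢v _ = contradiction refl v≢v
pos-map+ m v (x ∷ xs) (here refl) | tri> _ v≢v _ = contradiction refl v≢v
pos-map+ m v (x ∷ xs) (there v∈)  | tri< _ v≢x _ =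
  trans (pos-there (map (m +_) xs) (v≢x ∘ +-cancelˡ-≡ m v x))
      (trans (cong suc (pos-map+ m v xs v∈)) (sym (pos-there xs v≢x)))
pos-map+ m v (x ∷ xs) (there v∈)  | tri> _ v≢x _ =
  trans (pos-there (map (m +_) xs) (v≢x ∘ +-cancelˡ-≡ m v x))
      (trans (cong suc (pos-map+ m v xs v∈)) (sym (pos-there xs v≢x)))

!-suc : ∀ x xs {p} → 1 ≤ p → (x ∷ xs) ! suc p ≡ xs ! p
!-suc x xs (s≤s z≤n) = refl

pos-bounds : ∀ {v xs} → v ∈ xs → 1 ≤ pos v xs × pos v xs ≤ length xs × xs ! pos v xs ≡ v
pos-bounds {v} {x ∷ xs} v∈ with v ≡ᵇ x in eq
... | true  = s≤s z≤n , s≤s z≤n , sym (≡ᵇ⇒≡ v x (subst T (sym eq) tt))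
pos-bounds {v} {x ∷ xs} (here refl) | false = ⊥-elim (subst T eq (≡⇒≡ᵇ v v refl))
pos-bounds {v} {x ∷ xs} (there v∈) | false with pos-bounds v∈
... | 1≤p , p≤n , e = s≤s z≤n , s≤s p≤n , trans (!-suc x xs 1≤p) e

!-∈ : ∀ {xs i} → 1 ≤ i → i ≤ length xs → xs ! i ∈ xs
!-∈ {x ∷ xs} {1}            _ _ = here refl
!-∈ {x ∷ xs} {suc (suc i)} _ (s≤s le) = there (!-∈ (s≤s z≤n) le)
!-∈ {[]} (s≤s z≤n) ()

pos-! : ∀ {xs i} → Unique xs → 1 ≤ i → i ≤ length xs → pos (xs ! i) xs ≡ i
pos-! {x ∷ xs} {1} _ _ _ = pos-here x xs
pos-! {x ∷ xs} {suc (suc i)} (x≢ ∷ u) _ (s≤s le) =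
  trans (pos-there xs (≢-sym (All.lookup x≢ (!-∈ (s≤s z≤n) le)))) (cong suc (pos-! u (s≤s z≤n) le))
pos-! {[]} _ (s≤s z≤n) ()

!-tabulate : ∀ xs → map (xs !_) (range1 (length xs)) ≡ xs
!-tabulate []       = refl
!-tabulate (x ∷ xs) = trans (cong (map ((x ∷ xs) !_)) (range1-cons (length xs)))
  (cong (x ∷_) (trans (sym (map-∘ (range1 (length xs))))
    (trans (map-cong-local (All.map (!-suc x xs) (range1-≥ (length xs)))) (!-tabulate xs))))

map-range1-! : ∀ (f : ℕ → ℕ) n {i} → 1 ≤ i → i ≤ n → map f (range1 n) ! i ≡ f i
map-range1-! f (suc n) {1} _ _ = refl
map-range1-! f (suc n) {suc (suc i)} _ (s≤s le) =
  trans (cong (λ z → map f z ! suc (suc i)) (range1-cons n))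
  (trans (cong (λ z → z ! suc i) (sym (map-∘ {g = f} {f = suc} (range1 n))))
      (map-range1-! (f ∘ suc) n (s≤s z≤n) le))
map-range1-! f zero (s≤s z≤n) ()

Unique-map : {A B : Set} {f : A → B} {xs : List A} → (∀ {x y} → x ∈ xs → y ∈ xs → f x ≡ f y → x ≡ y) →
    Unique xs → Unique (map f xs)
Unique-map inj []        = []
Unique-map inj (x≢ ∷ u) =
  All.map⁺ (All.tabulate λ y∈ eq → All.lookup x≢ y∈ (inj (here refl) (there y∈) eq)) ∷
  Unique-map (λ x∈ y∈ → inj (there x∈) (there y∈)) u

∈-IsPerm⁻ : ∀ {n π j} → IsPerm n π → j ∈ π → 1 ≤ j × j ≤ n
∈-IsPerm⁻ p j∈ = All.lookup (IsPerm-≥ p) j∈ , All.lookup (IsPerm-≤ p) j∈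

length-inv : ∀ π → length (inv π) ≡ length π
length-inv π = trans (length-map _ (range1 (length π))) (length-range1 (length π))

inv-involutive : ∀ {n π} → IsPerm n π → inv (inv π) ≡ π
inv-involutive {n} {π} p = trans (cong (λ k → map (λ j → pos j (inv π)) (range1 k)) (length-inv π))
  (trans (map-cong-local (All.tabulate λ j∈ → pos-inv (∈-IsPerm⁻ ↭-refl j∈))) (!-tabulate π))
  where
  ∈π : ∀ {j} → j ∈ range1 (length π) → j ∈ π
  ∈π j∈ = Perm.∈-resp-↭ (↭-sym p) (subst (λ k → _ ∈ range1 k) (IsPerm-length p) j∈)
  unique : Unique (inv π)
  unique = Unique-map (λ {x} {y} x∈ y∈ eq →
      trans (sym (proj₂ (proj₂ (pos-bounds (∈π x∈)))))
          (trans (cong (π !_) eq) (proj₂ (proj₂ (pos-bounds (∈π y∈))))))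
    (range1-unique (length π))
  pos-inv : ∀ {j} → 1 ≤ j × j ≤ length π → pos j (inv π) ≡ π ! j
  pos-inv {j} (1≤j , j≤n) with ∈-IsPerm⁻ p (!-∈ {π} 1≤j j≤n)
  ... | 1≤v , v≤n = trans (cong (λ z → pos z (inv π)) (sym inv-at))
    (pos-! unique 1≤v (≤-trans v≤ (≤-reflexive (sym (length-inv π)))))
    where
    v≤ : π ! j ≤ length π
    v≤ = subst (π ! j ≤_) (sym (IsPerm-length p)) v≤n
    inv-at : inv π ! (π ! j) ≡ j
    inv-at = trans (map-range1-! (λ v → pos v π) (length π) 1≤v v≤) (pos-! (IsPerm-unique p) 1≤j j≤n)

reverse-IsPerm : ∀ {n ρ} → IsPerm n ρ → IsPerm n (reverse ρ)
reverse-IsPerm {n} {ρ} p = ↭-trans (Perm.↭-reverse ρ) p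

rot-rot⁻¹ : ∀ {n ρ} → IsPerm n ρ → rot (rot⁻¹ ρ) ≡ ρ
rot-rot⁻¹ {n} {ρ} p = trans (cong reverse (inv-involutive (reverse-IsPerm p))) (reverse-involutive ρ)

rot⁻¹-rot : ∀ {n π} → IsPerm n π → rot⁻¹ (rot π) ≡ π
rot⁻¹-rot {n} {π} p = trans (cong inv (reverse-involutive (inv π))) (inv-involutive p)

-- The first entry of `rot π` is the position of the largest value: the last place for U; the first
-- place for D, which shifts all other positions by one.
rotated : List Step → List ℕ
rotated []      = [ 1 ]
rotated (U ∷ w) = 2 + length w ∷ rotated w
rotated (D ∷ w) = 1 ∷ map suc (rotated w)

reverse-map-range1 : ∀ (f : ℕ → ℕ) n → reverse (map f (range1 (suc n))) ≡ f (suc n) ∷ reverse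
    (map f (range1 n))
reverse-map-range1 f n = trans (cong (reverse ∘ map f) (range1-suc n))
  (trans (cong reverse (map-++ f (range1 n) [ suc n ])) (reverse-++ (map f (range1 n)) [ f (suc n) ]))

rot-valley : ∀ w → rot (valley w) ≡ rotated w
rot-valley w = trans (cong (λ k → reverse (map (λ j → pos j (valley w)) (range1 k)))
    (IsPerm-length (valley-↭ w))) (go w)
  where
  go : ∀ w → reverse (map (λ j → pos j (valley w)) (range1 (suc (length w)))) ≡ rotated w
  go []      = refl
  go (U ∷ w) = trans (reverse-map-range1 (λ j → pos j (valley (U ∷ w))) (suc (length w))) (cong₂ _∷_
    (trans (pos-++ʳ [ 2 + length w ] (All.map (λ le → ≢-sym (<⇒≢ (s≤s le))) (IsPerm-≤ (valley-↭ w))))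
      (trans (cong₂ _+_ (IsPerm-length (valley-↭ w)) (pos-here (2 + length w) []))
          (+-comm (suc (length w)) 1)))
    (trans (cong reverse (map-cong-local (All.tabulate λ j∈ → pos-++ˡ [ 2 + length w ]
        (Perm.∈-resp-↭ (↭-sym (valley-↭ w)) j∈)))) (go w)))
  go (D ∷ w) = trans (reverse-map-range1 (λ j → pos j (valley (D ∷ w))) (suc (length w))) (cong₂ _∷_
    (pos-here (2 + length w) (valley w))
    (trans (cong reverse (trans (map-cong-local (All.map (λ j≤ → pos-there (valley w) (<⇒≢ (s≤s j≤)))
        (range1-≤ (suc (length w)))))
        (map-∘ {g = suc} {f = λ j → pos j (valley w)} (range1 (suc (length w))))))
      (trans (sym (reverse-map suc (map (λ j → pos j (valley w)) (range1 (suc (length w))))))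
          (cong (map suc) (go w)))))

-- Slides m ρ ρ′: applying swu m, …, swu 1 in this order takes ρ to ρ′ through permutations.
data Slides : ℕ → List ℕ → List ℕ → Set where
  done : ∀ {ρ} → Slides 0 ρ ρ
  step : ∀ {m ρ ρ₁ ρ₂} → swu (suc m) ρ ≡ ρ₁ → ρ₁ ↭ ρ → Slides m ρ₁ ρ₂ → Slides (suc m) ρ ρ₂

Slides-↭ : ∀ {m ρ ρ′} → Slides m ρ ρ′ → ρ′ ↭ ρ
Slides-↭ done          = ↭-refl
Slides-↭ (step _ p sl) = ↭-trans (Slides-↭ sl) p

-- The fold applies the operator of the largest index first, and between consecutive ones
-- `rot (rot⁻¹ ρ)` collapses to `ρ`; the permutation carried by each `step` is what licenses this.
Slides-swl : ∀ {n m ρ ρ′} → IsPerm n ρ → Slides m ρ ρ′ → foldr swl-i (rot⁻¹ ρ) (range1 m) ≡ rot⁻¹ ρ′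
Slides-swl p done = refl
Slides-swl {n} {suc m} {ρ} p (step {ρ₁ = ρ₁} eq q sl) =
  trans (cong (foldr swl-i (rot⁻¹ ρ)) (range1-suc m))
  (trans (foldr-++ swl-i (rot⁻¹ ρ) (range1 m) [ suc m ])
  (trans (cong (λ z → foldr swl-i z (range1 m)) (cong rot⁻¹ (trans (cong (swu (suc m)) (rot-rot⁻¹ p)) eq)))
  (Slides-swl (↭-trans q p) sl)))

-- Sliding operators

-- With `slideʳ`, a top-level copy of the local functions of `swu`, definitionally equal to them.
slideˡ : ℕ → List ℕ → ℕ → ℕ
slideˡ i pre x = if x <ᵇ i then i ∸ suc (countᵇ (λ y → (y <ᵇ i) ∧ (x <ᵇ y)) pre) else x

slideʳ : ℕ → List ℕ → ℕ → ℕ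
slideʳ i post x = if x <ᵇ i then suc (countᵇ (λ y → y <ᵇ x) post) else x

swu-middle : ∀ {i} pre post → All (_≢ i) pre →
  swu i (pre ++ i ∷ post) ≡ map (slideˡ i pre) pre ++ i ∷ map (slideʳ i post) post
swu-middle pre post pre≢ rewrite splitAtVal-middle pre post pre≢ = refl

<ᵇ-true : ∀ {x y} → x < y → (x <ᵇ y) ≡ true
<ᵇ-true {x} {y} x<y with x <ᵇ y | <⇒<ᵇ x<y
... | true | _ = refl

<ᵇ-false : ∀ {x y} → y ≤ x → (x <ᵇ y) ≡ false
<ᵇ-false {x} {y} y≤x with x <ᵇ y in eq
... | true  = contradiction (<ᵇ⇒< x y (subst T (sym eq) tt)) (≤⇒≯ y≤x)
... | false = refl

<ᵇ-+ : ∀ m x y → (m + x <ᵇ m + y) ≡ (x <ᵇ y)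
<ᵇ-+ zero    x y = refl
<ᵇ-+ (suc m) x y = <ᵇ-+ m x y

countᵇ-++ : ∀ p xs ys → countᵇ p (xs ++ ys) ≡ countᵇ p xs + countᵇ p ys
countᵇ-++ p []       ys = refl
countᵇ-++ p (x ∷ xs) ys with p x
... | true  = cong suc (countᵇ-++ p xs ys)
... | false = countᵇ-++ p xs ys

countᵇ-map : ∀ p f xs → countᵇ p (map f xs) ≡ countᵇ (p ∘ f) xs
countᵇ-map p f []       = refl
countᵇ-map p f (x ∷ xs) with p (f x)
... | true  = cong suc (countᵇ-map p f xs)
... | false = countᵇ-map p f xs

countᵇ-cong : ∀ {p q xs} → All (λ x → p x ≡ q x) xs → countᵇ p xs ≡ countᵇ q xs
countᵇ-cong [] = refl
countᵇ-cong {p} {q} {x ∷ xs} (eq ∷ eqs) with p x | q x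
countᵇ-cong (refl ∷ eqs) | true  | _ = cong suc (countᵇ-cong eqs)
countᵇ-cong (refl ∷ eqs) | false | _ = countᵇ-cong eqs

countᵇ-none : ∀ {p xs} → All (λ x → p x ≡ false) xs → countᵇ p xs ≡ 0
countᵇ-none [] = refl
countᵇ-none {p} {x ∷ xs} (eq ∷ eqs) with p x
countᵇ-none (refl ∷ eqs) | _ = countᵇ-none eqs

countᵇ-↭ : ∀ {p xs ys} → xs ↭ ys → countᵇ p xs ≡ countᵇ p ys
countᵇ-↭ {p} q = Perm.↭-length (Perm.filter-↭ (T? ∘ p) q)

count-above : ∀ x n → countᵇ (x <ᵇ_) (range1 n) ≡ n ∸ x
count-above x zero    = sym (0∸n≡0 x)
count-above x (suc n) = trans (cong (countᵇ (x <ᵇ_)) (range1-suc n))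
  (trans (countᵇ-++ (x <ᵇ_) (range1 n) [ suc n ])
      (trans (cong (_+ countᵇ (x <ᵇ_) [ suc n ]) (count-above x n)) last-term))
  where
  last-term : (n ∸ x) + countᵇ (x <ᵇ_) [ suc n ] ≡ suc n ∸ x
  last-term with x ≤? n
  ... | yes x≤n rewrite <ᵇ-true (s≤s x≤n) = trans (+-comm (n ∸ x) 1) (sym (+-∸-assoc 1 x≤n))
  ... | no  x≰n rewrite <ᵇ-false (≰⇒> x≰n) = trans (+-identityʳ _)
          (trans (m≤n⇒m∸n≡0 (<⇒≤ (≰⇒> x≰n))) (sym (m≤n⇒m∸n≡0 (≰⇒> x≰n))))

count-below : ∀ x n → x ≤ n → countᵇ (_<ᵇ suc x) (range1 n) ≡ x
count-below x n x≤n with m≤n⇒∃[o]m+o≡n x≤n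
... | o , refl rewrite range1-++ x o = trans (countᵇ-++ (_<ᵇ suc x) (range1 x) _)
  (trans (cong₂ _+_ (trans (countᵇ-cong (All.map (λ le → <ᵇ-true (s≤s le)) (range1-≤ x)))
      (count-true (range1 x)))
                    (countᵇ-none (All.map⁺ (All.map (λ 1≤ → <ᵇ-false
                        (≤-trans (≤-reflexive (+-comm 1 x)) (+-monoʳ-≤ x 1≤))) (range1-≥ o)))))
  (trans (+-identityʳ _) (length-range1 x)))
  where
  count-true : ∀ xs → countᵇ (λ _ → true) xs ≡ length xs
  count-true []       = refl
  count-true (_ ∷ xs) = cong suc (count-true xs)

-- Sliding at i = a + m + 1 when the smaller entries on the left, in order, are a consecutive increasing
-- run and those on the right form a shifted permutation of [m].
swu-block : ∀ {m τ} a c e hi → c ≤ m → e ≤ a → All (suc (a + m) ≤_) hi → IsPerm m τ →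
  swu (suc (a + m)) (map (c +_) (range1 a) ++ suc (a + m) ∷ hi ++ map (e +_) τ)
    ≡ map (m +_) (range1 a) ++ suc (a + m) ∷ hi ++ τ
swu-block {m} {τ} a c e hi c≤m e≤a hi≥ p = trans
    (swu-middle pre post (All.map <⇒≢ (All.map⁺ (All.map c+x<i (range1-≤ a)))))
  (cong₂ (λ u v → u ++ i ∷ v)
    (trans (sym (map-∘ (range1 a))) (map-cong-local (All.map left (range1-≤ a))))
    (trans (map-++ (slideʳ i post) hi (map (e +_) τ)) (cong₂ _++_
      (trans (map-cong-local (All.map right-high hi≥)) (map-id hi))
      (trans (sym (map-∘ τ)) (trans (map-cong-local (All.tabulate λ y∈ → right (∈-IsPerm⁻ p y∈)))
          (map-id τ))))))
  where
  i = suc (a + m)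
  pre = map (c +_) (range1 a)
  post = hi ++ map (e +_) τ
  c+x<i : ∀ {x} → x ≤ a → c + x < i
  c+x<i x≤a = s≤s (≤-trans (+-mono-≤ c≤m x≤a) (≤-reflexive (+-comm m a)))
  count-left : ∀ x → countᵇ (λ y → (y <ᵇ i) ∧ (c + x <ᵇ y)) pre ≡ a ∸ x
  count-left x = trans (countᵇ-map _ (c +_) (range1 a)) (trans
    (countᵇ-cong (All.map (λ {y} y≤a → trans (cong (_∧ (c + x <ᵇ c + y)) (<ᵇ-true (c+x<i y≤a)))
        (<ᵇ-+ c x y)) (range1-≤ a)))
    (count-above x a))
  -- The `x`-th entry of the run has `a ∸ x` larger ones before `i`, so it lands on
  -- `(a + m) - (a - x) = m + x`, whatever the offset `c` was.
  left : ∀ {x} → x ≤ a → slideˡ i pre (c + x) ≡ m + x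
  left {x} x≤a rewrite <ᵇ-true (c+x<i x≤a) | count-left x = trans (cong (_∸ (a ∸ x)) (+-comm a m))
    (trans (+-∸-assoc m (m∸n≤m a x)) (cong (m +_) (m∸[m∸n]≡n x≤a)))
  right-high : ∀ {x} → i ≤ x → slideʳ i post x ≡ x
  right-high i≤x rewrite <ᵇ-false i≤x = refl
  right : ∀ {y} → 1 ≤ y × y ≤ m → slideʳ i post (e + y) ≡ y
  right {suc y} (_ , y<m) rewrite <ᵇ-true (s≤s (+-mono-≤ e≤a y<m)) = cong suc (begin
    countᵇ (_<ᵇ e + suc y) (hi ++ map (e +_) τ)
      ≡⟨ countᵇ-++ (_<ᵇ e + suc y) hi _ ⟩
    countᵇ (_<ᵇ e + suc y) hi + countᵇ (_<ᵇ e + suc y) (map (e +_) τ)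
      ≡⟨ cong₂ _+_ (countᵇ-none (All.map (λ i≤ → <ᵇ-false (≤-trans (m≤n⇒m≤1+n (+-mono-≤ e≤a y<m)) i≤)) hi≥))
           (trans (countᵇ-map (_<ᵇ e + suc y) (e +_) τ) (countᵇ-cong
               (All.universal (λ z → <ᵇ-+ e z (suc y)) τ))) ⟩
    countᵇ (_<ᵇ suc y) τ
      ≡⟨ trans (countᵇ-↭ p) (count-below y m (<⇒≤ y<m)) ⟩
    y ∎)
    where open ≡-Reasoning

-- Entries above `i` are neither changed nor counted.
swu-prefix : ∀ {i τ} hi → Unique τ → i ∈ τ → All (i <_) hi → swu i (hi ++ τ) ≡ hi ++ swu i τ
swu-prefix {i} hi u i∈ hi> with ∈-∃++ i∈
... | L , R , refl = begin
  swu i (hi ++ L ++ i ∷ R)                              ≡⟨ cong (swu i) (sym (++-assoc hi L (i ∷ R))) ⟩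
  swu i ((hi ++ L) ++ i ∷ R)                            ≡⟨ swu-middle (hi ++ L) R
      (All.++⁺ (All.map (λ lt → ≢-sym (<⇒≢ lt)) hi>) L≢) ⟩
  map (slideˡ i (hi ++ L)) (hi ++ L) ++ i ∷ map (slideʳ i R) R
    ≡⟨ cong (_++ i ∷ map (slideʳ i R) R) (trans (map-++ _ hi L) (cong₂ _++_
         (trans (map-cong-local (All.map high hi>)) (map-id hi)) (map-cong low L))) ⟩
  (hi ++ map (slideˡ i L) L) ++ i ∷ map (slideʳ i R) R  ≡⟨ ++-assoc hi _ _ ⟩
  hi ++ map (slideˡ i L) L ++ i ∷ map (slideʳ i R) R    ≡⟨ cong (hi ++_) (sym (swu-middle L R L≢)) ⟩
  hi ++ swu i (L ++ i ∷ R)                              ∎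
  where
  open ≡-Reasoning
  L≢ : All (_≢ i) L
  L≢ = All.tabulate λ x∈ → λ { refl → Unique-middle L u x∈ }
    where
    Unique-middle : ∀ L {i : ℕ} {R} → Unique (L ++ i ∷ R) → i ∉ L
    Unique-middle (x ∷ L) (x≢ ∷ u) (here refl) = All.lookup x≢ (∈-++⁺ʳ L (here refl)) refl
    Unique-middle (x ∷ L) (x≢ ∷ u) (there i∈) = Unique-middle L u i∈
  high : ∀ {x} → i < x → slideˡ i (hi ++ L) x ≡ x
  high i<x rewrite <ᵇ-false (<⇒≤ i<x) = refl
  low : ∀ x → slideˡ i (hi ++ L) x ≡ slideˡ i L x
  low x = cong (λ z → if x <ᵇ i then i ∸ suc z else x) (trans (countᵇ-++ _ hi L)
    (cong (_+ countᵇ (λ y → (y <ᵇ i) ∧ (x <ᵇ y)) L)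
      (countᵇ-none (All.map (λ {y} i<y → cong (_∧ (x <ᵇ y)) (<ᵇ-false (<⇒≤ i<y))) hi>))))

Slides-prefix : ∀ {n m τ τ′} hi → IsPerm n τ → m ≤ n → All (n <_) hi → Slides m τ τ′ →
    Slides m (hi ++ τ) (hi ++ τ′)
Slides-prefix hi p m≤n hi> done = done
Slides-prefix hi p m≤n hi> (step eq q sl) = step
  (trans (swu-prefix hi (IsPerm-unique p) (IsPerm-∈ p (s≤s z≤n) m≤n)
      (All.map (λ lt → ≤-<-trans m≤n lt) hi>)) (cong (hi ++_) eq))
  (Perm.++⁺ˡ hi q) (Slides-prefix hi (↭-trans q p) (<⇒≤ m≤n) hi> sl)

run-split : ∀ m a b → map (m +_) (range1 (suc (a + b))) ≡ map (m +_) (range1 a) ++ suc (a + m) ∷ map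
    (λ x → suc (m + (a + x))) (range1 b)
run-split m a b = trans (cong (map (m +_) ∘ range1) (sym (+-suc a b)))
  (trans (cong (map (m +_)) (range1-++ a (suc b)))
  (trans (map-++ (m +_) (range1 a) _)
  (cong (map (m +_) (range1 a) ++_) (trans (sym (map-∘ (range1 (suc b))))
      (trans (cong (map (λ x → m + (a + x))) (range1-cons b))
    (cong₂ _∷_ (trans (cong (m +_) (+-comm a 1)) (trans (+-suc m a) (cong suc (+-comm m a))))
      (trans (sym (map-∘ (range1 b))) (map-cong (λ x → trans (cong (m +_) (+-suc a x)) (+-suc m (a + x)))
          (range1 b)))))))))

-- `swu-block` with `c = m` and `e = 0` is the identity. The argument `a` counts the pending
-- operators of the run, while `a + b` keeps its length fixed.
Slides-run : ∀ {m τ ρ} a b → IsPerm m τ → Slides m (map (m +_) (range1 (suc (a + b))) ++ τ) ρ →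
  Slides (a + m) (map (m +_) (range1 (suc (a + b))) ++ τ) ρ
Slides-run zero b p sl = sl
Slides-run {m} {τ} {ρ} (suc a) b p sl = step fixed ↭-refl
    (subst (λ z → Slides (a + m) (map (m +_) (range1 (suc z)) ++ τ) ρ) (+-suc a b)
    (Slides-run a (suc b) p (subst (λ z → Slides m (map (m +_) (range1 (suc z)) ++ τ) ρ)
        (sym (+-suc a b)) sl)))
  where
  hi = map (λ x → suc (m + (a + x))) (range1 (suc b))
  eq : map (m +_) (range1 (suc (suc a + b))) ++ τ ≡ map (m +_) (range1 a) ++ suc (a + m) ∷ hi ++ τ
  eq = trans (cong (λ z → map (m +_) (range1 (suc z)) ++ τ) (sym (+-suc a b)))
    (trans (cong (_++ τ) (run-split m a (suc b))) (++-assoc (map (m +_) (range1 a)) _ τ))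
  fixed : swu (suc (a + m)) (map (m +_) (range1 (suc (suc a + b))) ++ τ) ≡ map (m +_)
      (range1 (suc (suc a + b))) ++ τ
  fixed = trans (cong (swu (suc (a + m))) (trans eq
      (cong (λ z → map (m +_) (range1 a) ++ suc (a + m) ∷ hi ++ z) (sym (map-id τ)))))
    (trans (swu-block a m 0 hi ≤-refl z≤n (All.map⁺
        (All.universal (λ x → s≤s (≤-trans (≤-reflexive (+-comm a m)) (+-monoʳ-≤ m (m≤m+n a x))))
        (range1 (suc b)))) p)
    (sym eq))

run-↭ : ∀ {m τ} j → IsPerm m τ → IsPerm (suc (j + m)) (map (m +_) (range1 (suc j)) ++ τ)
run-↭ {m} {τ} j p = ↭-trans (Perm.++⁺ˡ _ p) (↭-trans (Perm.++-comm (map (m +_) (range1 (suc j))) (range1 m))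
  (↭-reflexive (trans (sym (range1-++ m (suc j))) (cong range1 (+-comm m (suc j))))))

-- Only the first operator touches the block: `swu-block` with `c = 0` and `e = j` lifts the `j`
-- small entries to just below their U and lowers `τ` to `[m]`. The next `j` operators do nothing,
-- and the remaining ones act behind the run.
Slides-block : ∀ {m τ τ′} j → IsPerm m τ → Slides m τ τ′ →
  Slides (suc (j + m)) (range1 j ++ suc (j + m) ∷ map (j +_) τ) (map (m +_) (range1 (suc j)) ++ τ′)
Slides-block {m} {τ} {τ′} j p sl = step
  (trans (cong (λ z → swu (suc (j + m)) (z ++ suc (j + m) ∷ map (j +_) τ)) (sym (map-id (range1 j))))
    (trans (swu-block j 0 j [] z≤n ≤-refl [] p) eq))
  (↭-trans (run-↭ j p) (↭-sym start))
  (subst (λ z → Slides (j + m) (map (m +_) (range1 (suc z)) ++ τ) (map (m +_) (range1 (suc j)) ++ τ′))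
      (+-identityʳ j)
    (Slides-run j 0 p (subst (λ z → Slides m (map (m +_) (range1 (suc z)) ++ τ)
        (map (m +_) (range1 (suc j)) ++ τ′)) (sym (+-identityʳ j))
      (Slides-prefix _ p ≤-refl (All.map⁺ (All.map (λ 1≤ → ≤-trans (≤-reflexive (+-comm 1 m))
          (+-monoʳ-≤ m 1≤)) (range1-≥ (suc j)))) sl))))
  where
  eq : map (m +_) (range1 j) ++ suc (j + m) ∷ τ ≡ map (m +_) (range1 (suc j)) ++ τ
  eq = sym (trans (cong (λ z → map (m +_) (range1 (suc z)) ++ τ) (sym (+-identityʳ j)))
    (trans (cong (_++ τ) (run-split m j 0)) (++-assoc (map (m +_) (range1 j)) _ τ)))
  start : IsPerm (suc (j + m)) (range1 j ++ suc (j + m) ∷ map (j +_) τ)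
  start = ↭-trans (Perm.++⁺ˡ (range1 j) (↭-trans (Perm.∷↭∷ʳ _ _)
      (Perm.++⁺ʳ [ suc (j + m) ] (Perm.map⁺ (j +_) p))))
    (↭-reflexive (trans (sym (++-assoc (range1 j) _ _))
        (trans (cong (_++ [ suc (j + m) ]) (sym (range1-++ j m))) (sym (range1-suc (j + m))))))

-- Descents after sliding

data Blocks : List Step → Set where
  final : ∀ j → Blocks (replicate j D)
  run   : ∀ j {w} → Blocks w → Blocks (replicate j D ++ U ∷ w)

blocks : ∀ w → Blocks w
blocks []      = final 0
blocks (U ∷ w) = run 0 (blocks w)
blocks (D ∷ w) with blocks w
... | final j = final (suc j)
... | run j b = run (suc j) b

-- The result of sliding rotated w: a descending sequence of runs of consecutive increasing values.
slid : ∀ {w} → Blocks w → List ℕ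
slid (final j)     = range1 (suc j)
slid (run j {w} b) = map (suc (length w) +_) (range1 (suc j)) ++ slid b

rotated-↭ : ∀ w → IsPerm (suc (length w)) (rotated w)
rotated-↭ []      = ↭-refl
rotated-↭ (U ∷ w) = ↭-trans (prep _ (rotated-↭ w))
    (↭-trans (Perm.∷↭∷ʳ _ _) (↭-reflexive (sym (range1-suc _))))
rotated-↭ (D ∷ w) = ↭-trans (prep 1 (Perm.map⁺ suc (rotated-↭ w))) (↭-reflexive (sym (range1-cons _)))

rotated-D : ∀ j {u τ x} → rotated u ≡ x ∷ τ → rotated (replicate j D ++ u) ≡ range1 j ++ j + x ∷ map (j +_) τ
rotated-D zero    eq = trans eq (cong (_ ∷_) (sym (map-id _)))
rotated-D (suc j) {u} {τ} {x} eq = trans (cong (λ z → 1 ∷ map suc z) (rotated-D j eq))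
  (trans (cong (1 ∷_) (trans (map-++ suc (range1 j) _)
      (cong (λ z → map suc (range1 j) ++ suc (j + x) ∷ z) (sym (map-∘ τ)))))
    (cong (_++ suc (j + x) ∷ map (suc j +_) τ) (sym (range1-cons j))))

slides : ∀ {w} (b : Blocks w) → Slides (suc (length w)) (rotated w) (slid b)
-- The closing stretch of D has no U; the terminal entry 1 of `rotated` takes its place, over the
-- empty permutation.
slides (final j) = subst₂ (λ ρ ρ′ → Slides (suc (length (replicate j D))) ρ ρ′)
  (trans (cong (λ z → range1 j ++ z ∷ []) (sym (+-suc j 0)))
      (sym (trans (cong rotated (sym (++-identityʳ (replicate j D)))) (rotated-D j {[]} refl))))
  (trans (++-identityʳ _) (map-id (range1 (suc j))))
  (subst (λ n → Slides (suc n) (range1 j ++ suc (j + 0) ∷ []) (map (0 +_) (range1 (suc j)) ++ []))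
      (trans (+-identityʳ j) (sym (length-replicate j)))
    (Slides-block j ↭-refl done))
slides (run j {w} b) = subst₂ (λ n ρ → Slides (suc n) ρ (slid (run j b)))
  (trans (cong (_+ suc (length w)) (sym (length-replicate j {D}))) (sym (length-++ (replicate j D))))
  (sym (trans (rotated-D j {U ∷ w} refl) (cong (λ z → range1 j ++ z ∷ map (j +_) (rotated w))
      (+-suc j (suc (length w))))))
  (Slides-block j (rotated-↭ w) (slides b))

slid-↭ : ∀ {w} (b : Blocks w) → IsPerm (suc (length w)) (slid b)
slid-↭ {w} b = ↭-trans (Slides-↭ (slides b)) (rotated-↭ w)

inv-⊕ : ∀ {m n α β} → IsPerm m α → IsPerm n β → inv (α ++ map (m +_) β) ≡ inv α ++ map (m +_) (inv β)
inv-⊕ {m} {n} {α} {β} pα pβ = begin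
  map f (range1 (length (α ++ map (m +_) β)))
    ≡⟨ cong (map f ∘ range1) (trans (length-++ α)
        (cong₂ _+_ (IsPerm-length pα) (trans (length-map (m +_) β) (IsPerm-length pβ)))) ⟩
  map f (range1 (m + n))
    ≡⟨ trans (cong (map f) (range1-++ m n)) (map-++ f (range1 m) _) ⟩
  map f (range1 m) ++ map f (map (m +_) (range1 n))
    ≡⟨ cong₂ _++_ (map-cong-local (All.tabulate λ x∈ → pos-++ˡ _ (Perm.∈-resp-↭ (↭-sym pα) x∈)))
         (trans (sym (map-∘ (range1 n))) (trans (map-cong-local (All.tabulate shifted)) (map-∘ (range1 n)))) ⟩
  map (λ j → pos j α) (range1 m) ++ map (m +_) (map (λ j → pos j β) (range1 n))
    ≡⟨ sym (cong₂ (λ a b → map (λ j → pos j α) (range1 a) ++ map (m +_) (map (λ j → pos j β) (range1 b)))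
        (IsPerm-length pα) (IsPerm-length pβ)) ⟩
  inv α ++ map (m +_) (inv β) ∎
  where
  open ≡-Reasoning
  f : ℕ → ℕ
  f j = pos j (α ++ map (m +_) β)
  shifted : ∀ {x} → x ∈ range1 n → f (m + x) ≡ m + pos x β
  shifted {x} x∈ = trans (pos-++ʳ _ (All.map (λ y≤m →
      ≢-sym (<⇒≢ (≤-<-trans y≤m (≤-trans (≤-reflexive (+-comm 1 m))
      (+-monoʳ-≤ m (proj₁ (∈-IsPerm⁻ ↭-refl x∈))))))) (IsPerm-≤ pα)))
    (cong₂ _+_ (IsPerm-length pα) (pos-map+ m x β (Perm.∈-resp-↭ (↭-sym pβ) x∈)))

reverse-range1 : ∀ n → reverse (range1 (suc n)) ≡ suc n ∷ reverse (range1 n)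
reverse-range1 n = trans (cong reverse (range1-suc n)) (reverse-++ (range1 n) [ suc n ])

pos-reverse-range1 : ∀ n {x} → 1 ≤ x → x ≤ n → pos x (reverse (range1 n)) ≡ suc n ∸ x
pos-reverse-range1 (suc n) {x} 1≤x x≤n with m≤n⇒m<n∨m≡n x≤n
... | inj₂ refl = trans (cong (pos (suc n)) (reverse-range1 n))
    (trans (pos-here (suc n) (reverse (range1 n)))
    (sym (trans (+-∸-assoc 1 {suc n} ≤-refl) (cong suc (n∸n≡0 (suc n))))))
... | inj₁ (s≤s x≤n′) = trans (cong (pos x) (reverse-range1 n))
    (trans (pos-there (reverse (range1 n)) (<⇒≢ (s≤s x≤n′)))
  (trans (cong suc (pos-reverse-range1 n 1≤x x≤n′)) (sym (+-∸-assoc 1 x≤n))))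
pos-reverse-range1 zero (s≤s z≤n) ()

complement-range1 : ∀ n → map (λ x → suc n ∸ x) (range1 n) ≡ reverse (range1 n)
complement-range1 zero    = refl
complement-range1 (suc n) = trans (cong (map (λ x → 2 + n ∸ x)) (range1-cons n))
  (trans (cong (suc n ∷_) (trans (sym (map-∘ (range1 n))) (complement-range1 n))) (sym (reverse-range1 n)))

inv-reverse-range1 : ∀ n → inv (reverse (range1 n)) ≡ reverse (range1 n)
inv-reverse-range1 n = trans (cong (map (λ j → pos j (reverse (range1 n))) ∘ range1)
    (trans (length-reverse (range1 n)) (length-range1 n)))
  (trans (map-cong-local (All.tabulate λ x∈ → pos-reverse-range1 n (All.lookup (range1-≥ n) x∈)
      (All.lookup (range1-≤ n) x∈))) (complement-range1 n))

inv-reverse-slid : ∀ {w} (b : Blocks w) → inv (reverse (slid b)) ≡ reverse (slid b)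
inv-reverse-slid (final j)     = inv-reverse-range1 (suc j)
inv-reverse-slid (run j {w} b) = trans (cong inv eq)
  (trans (inv-⊕ (reverse-IsPerm (slid-↭ b)) (Perm.↭-reverse (range1 (suc j))))
  (trans (cong₂ (λ u v → u ++ map (suc (length w) +_) v) (inv-reverse-slid b) (inv-reverse-range1 (suc j)))
      (sym eq)))
  where
  eq : reverse (slid (run j b)) ≡ reverse (slid b) ++ map (suc (length w) +_) (reverse (range1 (suc j)))
  eq = trans (reverse-++ (map (suc (length w) +_) (range1 (suc j))) (slid b))
    (cong (reverse (slid b) ++_) (sym (reverse-map (suc (length w) +_) (range1 (suc j)))))

swl-valley : ∀ w → swl (valley w) ≡ reverse (slid (blocks w))
swl-valley w = begin
  foldr swl-i (valley w) (range1 (length (valley w)))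
    ≡⟨ cong₂ (λ π n → foldr swl-i π (range1 n)) (trans (sym (rot⁻¹-rot (valley-↭ w)))
        (cong rot⁻¹ (rot-valley w))) (IsPerm-length (valley-↭ w)) ⟩
  foldr swl-i (rot⁻¹ (rotated w)) (range1 (suc (length w)))
    ≡⟨ Slides-swl (rotated-↭ w) (slides (blocks w)) ⟩
  rot⁻¹ (slid (blocks w))
    ≡⟨ inv-reverse-slid (blocks w) ⟩
  reverse (slid (blocks w)) ∎
  where open ≡-Reasoning

-- Being its own inverse, `reverse (slid (blocks w))` equals `rot⁻¹ (slid (blocks w))`, and `rot`
-- cancels.
rot-swl-valley : ∀ w → rot (swl (valley w)) ≡ slid (blocks w)
rot-swl-valley w = trans (cong rot (trans (swl-valley w) (sym (inv-reverse-slid (blocks w)))))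
    (rot-rot⁻¹ (slid-↭ (blocks w)))

-- Letters follow the convention of `Λ′`. Reversing a list exchanges descents and ascents and
-- reverses the indices, and `Λ` differs from `Λ′` in exactly these two ways, so one word serves
-- both components.
data Reads : List ℕ → List Step → Set where
  end  : ∀ {x} → Reads [ x ] []
  down : ∀ {x y l w} → y < x → Reads (y ∷ l) w → Reads (x ∷ y ∷ l) (U ∷ w)
  up   : ∀ {x y l w} → x < y → Reads (y ∷ l) w → Reads (x ∷ y ∷ l) (D ∷ w)

Reads-run : ∀ j f {ρ w} → (∀ x → f x < f (suc x)) → Reads (f (suc j) ∷ ρ) w →
  Reads (map f (range1 (suc j)) ++ ρ) (replicate j D ++ w)
Reads-run zero    f inc r = r
Reads-run (suc j) f {ρ} {w} inc r = subst (λ l → Reads (f 1 ∷ l ++ ρ) (D ∷ replicate j D ++ w)) eq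
  (up (inc 1) (Reads-run j (f ∘ suc) (inc ∘ suc) r))
  where
  eq : map (f ∘ suc) (range1 (suc j)) ≡ map f (map suc (applyUpTo suc (suc j)))
  eq = trans (map-∘ {g = f} {f = suc} (range1 (suc j))) (cong (map f ∘ map suc) (map-upTo suc (suc j)))

Reads-slid : ∀ {w} (b : Blocks w) → Reads (slid b) w
Reads-slid (final j) = subst₂ Reads (trans (++-identityʳ _) (map-id (range1 (suc j))))
    (++-identityʳ (replicate j D)) (Reads-run j id n<1+n end)
Reads-slid (run j {w} b) with slid b | Reads-slid b | IsPerm-≤ (slid-↭ b)
... | x ∷ ρ | r | x≤ ∷ _ = Reads-run j (suc (length w) +_) (λ y → +-monoʳ-< (suc (length w)) (n<1+n y))
  (down (≤-<-trans x≤ (m<m+n (suc (length w)) z<s)) r)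

!-++ˡ : ∀ xs ys {i} → i ≤ length xs → (xs ++ ys) ! i ≡ xs ! i
!-++ˡ []       []       _ = refl
!-++ˡ []       (y ∷ ys) z≤n = refl
!-++ˡ (x ∷ xs) ys {0}           _        = refl
!-++ˡ (x ∷ xs) ys {1}           _        = refl
!-++ˡ (x ∷ xs) ys {suc (suc i)} (s≤s le) = !-++ˡ xs ys le

isDes-++ˡ : ∀ xs ys {i} → i < length xs → isDes (xs ++ ys) i ≡ isDes xs i
isDes-++ˡ xs ys {zero}  lt = refl
isDes-++ˡ xs ys {suc i} lt = cong₂ _∧_
  (trans (<ᵇ-true (s≤s (≤-trans lt (≤-trans (m≤m+n _ _) (≤-reflexive (sym (length-++ xs)))))))
      (sym (<ᵇ-true (s≤s lt))))
  (cong₂ _<ᵇ_ (!-++ˡ xs ys lt) (!-++ˡ xs ys (<⇒≤ lt)))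

isDes-end : ∀ xs y x → isDes (xs ++ y ∷ x ∷ []) (suc (length xs)) ≡ (x <ᵇ y)
isDes-end []            y x = refl
isDes-end (_ ∷ [])      y x = refl
isDes-end (_ ∷ z ∷ xs) y x = isDes-end (z ∷ xs) y x

map-range1-cons : ∀ {A : Set} (f : ℕ → A) n → map f (range1 (suc n)) ≡ f 1 ∷ map (f ∘ suc) (range1 n)
map-range1-cons f n = trans (cong (map f) (range1-cons n)) (cong (f 1 ∷_) (sym (map-∘ (range1 n))))

isDes-there : ∀ x xs {i} → 1 ≤ i → isDes (x ∷ xs) (suc i) ≡ isDes xs i
isDes-there x xs (s≤s z≤n) = refl

Reads-isDes : ∀ {ρ w} → Reads ρ w → map (λ i → if isDes ρ i then U else D) (range1 (length w)) ≡ w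
Reads-isDes end = refl
Reads-isDes {x ∷ y ∷ l} {_ ∷ w} (down y<x r) =
    trans (map-range1-cons (λ i → if isDes (x ∷ y ∷ l) i then U else D) (length w)) (cong₂ _∷_
  (cong (λ b → if b then U else D) (<ᵇ-true y<x))
  (trans (map-cong-local (All.map (λ 1≤i → cong (λ b → if b then U else D) (isDes-there x (y ∷ l) 1≤i))
      (range1-≥ (length w)))) (Reads-isDes r)))
Reads-isDes {x ∷ y ∷ l} {_ ∷ w} (up x<y r) = trans
    (map-range1-cons (λ i → if isDes (x ∷ y ∷ l) i then U else D) (length w)) (cong₂ _∷_
  (cong (λ b → if b then U else D) (<ᵇ-false (<⇒≤ x<y)))
  (trans (map-cong-local (All.map (λ 1≤i → cong (λ b → if b then U else D) (isDes-there x (y ∷ l) 1≤i))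
      (range1-≥ (length w)))) (Reads-isDes r)))

Reads-length : ∀ {ρ w} → Reads ρ w → length ρ ≡ suc (length w)
Reads-length end        = refl
Reads-length (down _ r) = cong suc (Reads-length r)
Reads-length (up _ r)   = cong suc (Reads-length r)

Reads-reverse : ∀ {ρ w} → Reads ρ w →
  map (λ i → if isDes (reverse ρ) (suc (length w) ∸ i) then D else U) (range1 (length w)) ≡ w
Reads-reverse-cons : ∀ {x y l w} a → (if x <ᵇ y then D else U) ≡ a → Reads (y ∷ l) w →
  map (λ i → if isDes (reverse (x ∷ y ∷ l)) (2 + length w ∸ i) then D else U)
      (range1 (suc (length w))) ≡ a ∷ w

Reads-reverse end          = refl
Reads-reverse (down y<x r) = Reads-reverse-cons U (cong (λ b → if b then D else U) (<ᵇ-false (<⇒≤ y<x))) r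
Reads-reverse (up x<y r)   = Reads-reverse-cons D (cong (λ b → if b then D else U) (<ᵇ-true x<y)) r

Reads-reverse-cons {x} {y} {l} {w} a eq r = trans (map-range1-cons _ (length w)) (cong₂ _∷_
  (trans (cong (λ b → if b then D else U) first) eq)
  (trans (map-cong-local (All.tabulate λ i∈ → cong (λ b → if b then D else U) (rest (∈-IsPerm⁻ ↭-refl i∈))))
      (Reads-reverse r)))
  where
  len : length (reverse (y ∷ l)) ≡ suc (length w)
  len = trans (length-reverse (y ∷ l)) (Reads-length r)
  first : isDes (reverse (x ∷ y ∷ l)) (suc (length w)) ≡ (x <ᵇ y)
  first = trans (cong₂ isDes
      (trans (unfold-reverse x (y ∷ l)) (trans (cong (_++ [ x ]) (unfold-reverse y l))
          (++-assoc (reverse l) [ y ] [ x ])))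
      (trans (sym (Reads-length r)) (cong suc (sym (length-reverse l)))))
    (isDes-end (reverse l) y x)
  rest : ∀ {i} → 1 ≤ i × i ≤ length w →
    isDes (reverse (x ∷ y ∷ l)) (suc (length w) ∸ i) ≡ isDes (reverse (y ∷ l)) (suc (length w) ∸ i)
  rest {i} (1≤i , i≤w) = trans (cong (λ z → isDes z (suc (length w) ∸ i)) (unfold-reverse x (y ∷ l)))
    (isDes-++ˡ (reverse (y ∷ l)) [ x ] (subst (suc (length w) ∸ i <_) (sym len)
        (∸-monoʳ-< {suc (length w)} {i} {0} 1≤i (m≤n⇒m≤1+n i≤w))))

DL-valley : ∀ {k w} → length w ≡ 2 * k → DL k (swl (valley w)) ≡ (w , w)
DL-valley {k} {w} len = cong₂ _,_
  (trans (cong₂ (λ n π → map (λ i → if isDes π (suc n ∸ i) then D else U) (range1 n)) (sym len)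
      (swl-valley w)) (Reads-reverse r))
  (trans (cong₂ (λ n π → map (λ i → if isDes π i then U else D) (range1 n)) (sym len) (rot-swl-valley w))
      (Reads-isDes r))
  where
  r : Reads (slid (blocks w)) w
  r = Reads-slid (blocks w)

-- Counting Dyck words

-- Continuations from height `h` with `u` letters U to come. Without any U left only the descent to
-- 0 remains, and each step lowers `u`, or keeps `u` and lowers `h`.
dyckWords : ℕ → ℕ → List (List Step)
dyckWords h       zero    = [ replicate h D ]
dyckWords zero    (suc u) = map (U ∷_) (dyckWords 1 u)
dyckWords (suc h) (suc u) = map (U ∷_) (dyckWords (2 + h) u) ++ map (D ∷_) (dyckWords h (suc u))

replicate-dyck : ∀ h → DyckFrom h (replicate h D) × #U (replicate h D) ≡ 0
replicate-dyck zero    = refl , refl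
replicate-dyck (suc h) = replicate-dyck h

∈-dyckWords⁻ : ∀ h u {w} → w ∈ dyckWords h u → DyckFrom h w × #U w ≡ u
∈-dyckWords⁻ h zero (here refl) = replicate-dyck h
∈-dyckWords⁻ zero (suc u) w∈ with ∈-map⁻ (U ∷_) w∈
... | w , w∈′ , refl with ∈-dyckWords⁻ 1 u w∈′
... | dy , eq = dy , cong suc eq
∈-dyckWords⁻ (suc h) (suc u) w∈ with ∈-++⁻ (map (U ∷_) (dyckWords (2 + h) u)) w∈
... | inj₁ w∈′ with ∈-map⁻ (U ∷_) w∈′
...   | w , w∈″ , refl with ∈-dyckWords⁻ (2 + h) u w∈″
...     | dy , eq = dy , cong suc eq
∈-dyckWords⁻ (suc h) (suc u) w∈ | inj₂ w∈′ with ∈-map⁻ (D ∷_) w∈′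
...   | w , w∈″ , refl = ∈-dyckWords⁻ h (suc u) w∈″

no-ups : ∀ h w → DyckFrom h w → #U w ≡ 0 → w ≡ replicate h D
no-ups .0      []      refl eq = refl
no-ups (suc h) (D ∷ w) dy   eq = cong (D ∷_) (no-ups h w dy eq)

∈-dyckWords⁺ : ∀ h u {w} → DyckFrom h w → #U w ≡ u → w ∈ dyckWords h u
∈-dyckWords⁺ h       zero    {w}     dy eq = here (no-ups h w dy eq)
∈-dyckWords⁺ zero    (suc u) {U ∷ w} dy eq = ∈-map⁺ (U ∷_) (∈-dyckWords⁺ 1 u dy (suc-injective eq))
∈-dyckWords⁺ (suc h) (suc u) {U ∷ w} dy eq = ∈-++⁺ˡ
    (∈-map⁺ (U ∷_) (∈-dyckWords⁺ (2 + h) u dy (suc-injective eq)))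
∈-dyckWords⁺ (suc h) (suc u) {D ∷ w} dy eq =
  ∈-++⁺ʳ (map (U ∷_) (dyckWords (2 + h) u)) (∈-map⁺ (D ∷_) (∈-dyckWords⁺ h (suc u) dy eq))

dyckWords-unique : ∀ h u → Unique (dyckWords h u)
dyckWords-unique h       zero    = [] ∷ []
dyckWords-unique zero    (suc u) = Uniq.map⁺ ∷-injectiveʳ (dyckWords-unique 1 u)
dyckWords-unique (suc h) (suc u) = Uniq.++⁺ (Uniq.map⁺ ∷-injectiveʳ (dyckWords-unique (2 + h) u))
  (Uniq.map⁺ ∷-injectiveʳ (dyckWords-unique h (suc u)))
  λ (p , q) → case ∈-map⁻ (U ∷_) p , ∈-map⁻ (D ∷_) q of λ { ((_ , _ , refl) , (_ , _ , ())) }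

-- The binomial coefficient with lower index u - 1, which vanishes at u = 0.
_C⁻_ : ℕ → ℕ → ℕ
n C⁻ zero  = 0
n C⁻ suc u = n C u

nC0≡1 : ∀ n → n C 0 ≡ 1
nC0≡1 n = trans (nCk≡nC[n∸k] {0} {n} z≤n) (nCn≡1 n)

pascal⁻ : ∀ n u → suc n C⁻ suc u ≡ n C u + n C⁻ u
pascal⁻ n zero    = trans (nC0≡1 (suc n)) (sym (trans (+-identityʳ _) (nC0≡1 n)))
pascal⁻ n (suc u) = trans (sym (nCk+nC[k+1]≡[n+1]C[k+1] n u)) (+-comm (n C u) (n C suc u))

-- The ballot numbers C(n,u) - C(n,u-1), by the reflection recurrence.
length-dyckWords : ∀ h u → length (dyckWords h u) + (h + (u + u)) C⁻ u ≡ (h + (u + u)) C u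
length-dyckWords h zero = sym (nC0≡1 (h + 0))
length-dyckWords zero (suc u) rewrite +-suc u u = begin
  length (map (U ∷_) (dyckWords 1 u)) + suc n C⁻ suc u
    ≡⟨ cong₂ _+_ (length-map _ (dyckWords 1 u)) (pascal⁻ n u) ⟩
  length (dyckWords 1 u) + (n C u + n C⁻ u)
    ≡⟨ arith (length (dyckWords 1 u)) (n C u) (n C⁻ u) ⟩
  n C u + (length (dyckWords 1 u) + n C⁻ u)
    ≡⟨ cong (n C u +_) (trans (length-dyckWords 1 u) middle) ⟩
  n C u + n C suc u
    ≡⟨ nCk+nC[k+1]≡[n+1]C[k+1] n u ⟩
  suc n C suc u ∎
  where
  open ≡-Reasoning
  n = suc (u + u)
  arith : ∀ a b c → a + (b + c) ≡ b + (a + c)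
  arith = solve-∀
  -- At height 0 there is no D branch; the symmetry of the odd row `2u + 1` replaces it.
  middle : n C u ≡ n C suc u
  middle = trans (nCk≡nC[n∸k] (m≤n⇒m≤1+n (m≤m+n u u)))
      (cong (n C_) (trans (+-∸-assoc 1 (m≤m+n u u)) (cong suc (m+n∸m≡n u u))))
length-dyckWords (suc h) (suc u) = begin
  length (map (U ∷_) (dyckWords (2 + h) u) ++ map (D ∷_) (dyckWords h (suc u))) + suc n C⁻ suc u
    ≡⟨ cong₂ _+_ (trans (length-++ (map (U ∷_) (dyckWords (2 + h) u)))
        (cong₂ _+_ (length-map _ (dyckWords (2 + h) u)) (length-map _ (dyckWords h (suc u))))) (pascal⁻ n u) ⟩
  (a + b) + (n C u + n C⁻ u)
    ≡⟨ arith a b (n C u) (n C⁻ u) ⟩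
  (a + n C⁻ u) + (b + n C u)
    ≡⟨ cong₂ _+_ (subst (λ z → a + z C⁻ u ≡ z C u) (arith′ h u) (length-dyckWords (2 + h) u))
        (length-dyckWords h (suc u)) ⟩
  n C u + n C suc u
    ≡⟨ nCk+nC[k+1]≡[n+1]C[k+1] n u ⟩
  suc n C suc u ∎
  where
  open ≡-Reasoning
  n = h + (suc u + suc u)
  a = length (dyckWords (2 + h) u)
  b = length (dyckWords h (suc u))
  arith : ∀ a b c d → (a + b) + (c + d) ≡ (a + d) + (b + c)
  arith = solve-∀
  arith′ : ∀ h u → 2 + h + (u + u) ≡ h + (suc u + suc u)
  arith′ = solve-∀

-- Expresses two neighbouring binomials through each other without factorials; this converts the
-- difference in `length-dyckWords` into the quotient in `catalan`.
absorption : ∀ k m → suc k * ((k + m) C suc k) ≡ m * ((k + m) C k)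
absorption k zero = trans (cong (λ z → suc k * z) (k>n⇒nCk≡0 (s≤s (≤-reflexive (+-identityʳ k)))))
    (*-zeroʳ (suc k))
absorption zero (suc m) = trans (*-identityˡ (suc m C 1))
    (trans (nC1≡n (suc m)) (sym (trans (cong (suc m *_) (nC0≡1 (suc m))) (*-identityʳ (suc m)))))
absorption (suc k) (suc m) = begin
  (2 + k) * (suc n C (2 + k))                       ≡⟨ cong ((2 + k) *_)
      (sym (nCk+nC[k+1]≡[n+1]C[k+1] n (suc k))) ⟩
  (2 + k) * (n C suc k + n C (2 + k))               ≡⟨ *-distribˡ-+ (2 + k) (n C suc k) (n C (2 + k)) ⟩
  (2 + k) * (n C suc k) + (2 + k) * (n C (2 + k))
      ≡⟨ cong ((2 + k) * (n C suc k) +_) (subst (λ z → (2 + k) * (z C (2 + k)) ≡ m * (z C suc k))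
      (sym (+-suc k m)) (absorption (suc k) m)) ⟩
  (2 + k) * (n C suc k) + m * (n C suc k)           ≡⟨ arith k m (n C suc k) ⟩
  suc k * (n C suc k) + suc m * (n C suc k)         ≡⟨ cong (_+ suc m * (n C suc k)) (absorption k (suc m)) ⟩
  suc m * (n C k) + suc m * (n C suc k)             ≡⟨ sym (*-distribˡ-+ (suc m) (n C k) (n C suc k)) ⟩
  suc m * (n C k + n C suc k)                       ≡⟨ cong (suc m *_) (nCk+nC[k+1]≡[n+1]C[k+1] n k) ⟩
  suc m * (suc n C suc k)                           ∎
  where
  open ≡-Reasoning
  n = k + suc m
  arith : ∀ k m x → (2 + k) * x + m * x ≡ suc k * x + suc m * x
  arith = solve-∀

length-catalan : ∀ k → length (dyckWords 0 k) ≡ catalan k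
length-catalan zero    = refl
length-catalan (suc k) = sym (trans (cong (λ z → (z C suc k) / (2 + k))
    (cong (suc k +_) (+-identityʳ (suc k))))
  (trans (cong (_/ (2 + k)) (sym multiple)) (m*n/n≡m N (2 + k))))
  where
  open ≡-Reasoning
  N = length (dyckWords 0 (suc k))
  n = suc k + suc k
  absorb : suc k * (n C suc k) ≡ (2 + k) * (n C k)
  absorb = subst (λ z → suc k * (z C suc k) ≡ (2 + k) * (z C k)) (+-suc k (suc k)) (absorption k (2 + k))
  arith : ∀ N k c → N * (2 + k) + (2 + k) * c ≡ (2 + k) * (N + c)
  arith = solve-∀
  -- The division in `catalan` is truncated, so exact divisibility comes first; adding
  -- `(2 + k) * (n C k)` to both sides avoids subtraction.
  multiple : N * (2 + k) ≡ n C suc k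
  multiple = +-cancelʳ-≡ ((2 + k) * (n C k)) (N * (2 + k)) (n C suc k) (begin
    N * (2 + k) + (2 + k) * (n C k)     ≡⟨ arith N k (n C k) ⟩
    (2 + k) * (N + n C k)               ≡⟨ cong ((2 + k) *_) (length-dyckWords 0 (suc k)) ⟩
    (2 + k) * (n C suc k)               ≡⟨⟩
    n C suc k + suc k * (n C suc k)     ≡⟨ cong (n C suc k +_) absorb ⟩
    n C suc k + (2 + k) * (n C k)       ∎)

-- The bijection and the count

∈-dyckWords⇔ : ∀ k {w} → (w ∈ dyckWords 0 k → IsDyck k w) × (IsDyck k w → w ∈ dyckWords 0 k)
∈-dyckWords⇔ k {w} =
  (λ w∈ → let (dy , #U≡k) = ∈-dyckWords⁻ 0 k w∈ in
     #U≡k , trans (dyckFrom⇒balanced 0 w dy) #U≡k , λ { p q refl → dyckFrom⇒prefix 0 p q dy }) ,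
  (λ dyck → ∈-dyckWords⁺ 0 k (proj₁ (isDyck⇒dyckFrom {k} {w} dyck)) (proj₁ dyck))

DL-swl-valley : ∀ k {w} → IsDyck k w → DL k (swl (valley w)) ≡ (w , w)
DL-swl-valley k dyck = DL-valley {k} (proj₂ (isDyck⇒dyckFrom {k} dyck))

valley-injective : ∀ k {w w′} → IsDyck k w → IsDyck k w′ → DL k (swl (valley w)) ≡ DL k (swl (valley w′)) →
    w ≡ w′
valley-injective k dyck dyck′ eq = cong proj₁
    (trans (sym (DL-swl-valley k dyck)) (trans eq (DL-swl-valley k dyck′)))

theorem9p3 : ∀ (k : ℕ) →
    (∀ π → InU132-231 (suc (2 * k)) π →
    Σ (List Step) (λ Λ → IsDyck k Λ × DL k (swl π) ≡ (Λ , Λ)))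
    × (∀ π π′ → InU132-231 (suc (2 * k)) π → InU132-231 (suc (2 * k)) π′ →
    DL k (swl π) ≡ DL k (swl π′) → π ≡ π′)
    × (∀ Λ → IsDyck k Λ →
    Σ (List ℕ) (λ π → InU132-231 (suc (2 * k)) π × DL k (swl π) ≡ (Λ , Λ)))
    × Σ (List (List ℕ)) (λ L → Unique L
    × (∀ π → (π ∈ L) ⇔ InU132-231 (suc (2 * k)) π)
    × length L ≡ catalan k)
theorem9p3 k = into , injective , onto , map valley (dyckWords 0 k) , unique , (λ π → mk⇔ sound complete) ,
  trans (length-map valley (dyckWords 0 k)) (length-catalan k)
  where
  into : ∀ π → InU132-231 (suc (2 * k)) π → Σ (List Step) (λ Λ → IsDyck k Λ × DL k (swl π) ≡ (Λ , Λ))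
  into π π∈ with InU⇒valley {k} π∈
  ... | w , dyck , refl = w , dyck , DL-swl-valley k dyck
  injective : ∀ π π′ → InU132-231 (suc (2 * k)) π → InU132-231 (suc (2 * k)) π′ →
      DL k (swl π) ≡ DL k (swl π′) → π ≡ π′
  injective π π′ π∈ π′∈ eq with InU⇒valley {k} π∈ | InU⇒valley {k} π′∈
  ... | w , dyck , refl | w′ , dyck′ , refl = cong valley (valley-injective k dyck dyck′ eq)
  onto : ∀ Λ → IsDyck k Λ → Σ (List ℕ) (λ π → InU132-231 (suc (2 * k)) π × DL k (swl π) ≡ (Λ , Λ))
  onto Λ dyck = valley Λ , valley⇒InU {k} dyck , DL-swl-valley k dyck
  unique : Unique (map valley (dyckWords 0 k))
  -- Equal valleys have equal images under `DL k ∘ swl`, so the images already separate the listed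
  -- permutations.
  unique = Unique-map (λ w∈ w′∈ eq → valley-injective k (proj₁ (∈-dyckWords⇔ k) w∈)
      (proj₁ (∈-dyckWords⇔ k) w′∈) (cong (DL k ∘ swl) eq))
    (dyckWords-unique 0 k)
  sound : ∀ {π} → π ∈ map valley (dyckWords 0 k) → InU132-231 (suc (2 * k)) π
  sound π∈ with ∈-map⁻ valley π∈
  ... | w , w∈ , refl = valley⇒InU {k} (proj₁ (∈-dyckWords⇔ k) w∈)
  complete : ∀ {π} → InU132-231 (suc (2 * k)) π → π ∈ map valley (dyckWords 0 k)
  complete π∈ with InU⇒valley {k} π∈
  ... | w , dyck , refl = ∈-map⁺ valley (proj₂ (∈-dyckWords⇔ k) dyck)
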